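{- Let $n\ge1$, let $\overrightarrow{P_n}$ be the path on $n$ vertices with edges oriented in one direction, with underlying undirected graph $P_n$, and let $X_{\overrightarrow{P_n}}(\mathbf{x},t)=\sum_{\lambda\vdash n}c_\lambda(t)e_\lambda$. Then for every partition $\lambda=(\lambda_1,\dots,\lambda_k)$ of $n$, $$c_\lambda(t)=\sum_{\bar a\in AO_\lambda(P_n)}t^{\mathrm{asc}_{\overrightarrow{P_n}}(\bar a)},$$ where $AO_\lambda(P_n)$ is the set of all acyclic orientations $\bar a$ of $P_n$ such that the numbers of vertices between consecutive sinks of $\bar a$ (including, as one of these numbers, the total number of vertices before the first sink and after the last sink) are $\lambda_1-1,\lambda_2-1,\dots,\lambda_k-1$ in any order, and $\mathrm{asc}_{\overrightarrow{P_n}}(\bar a)$ is the number of edges of $\overrightarrow{P_n}$ for which the orientations of $\overrightarrow{P_n}$ and $\bar a$ agree.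
   Context: $\overrightarrow{P_n}$ is the digraph on $[n]$ with directed edges $1\to2\to\cdots\to n$. For a digraph $\overrightarrow{G}=(V,E)$, a proper coloring is a map $\kappa:V\to\mathbb{P}=\{1,2,3,\dots\}$ with $\kappa(u)\ne\kappa(v)$ whenever $u,v$ are adjacent, $\mathrm{asc}(\kappa)=|\{(u,v)\in E:\kappa(u)<\kappa(v)\}|$ (where $(u,v)$ is directed from $u$ to $v$), and $$X_{\overrightarrow{G}}(\mathbf{x},t)=\sum_{\kappa}t^{\mathrm{asc}(\kappa)}\prod_{v\in V}x_{\kappa(v)},$$ summed over all proper colorings. For $\overrightarrow{P_n}$ this is a polynomial in $t$ with symmetric function coefficients; $e_\lambda=e_{\lambda_1}e_{\lambda_2}\cdots$ are the elementary symmetric functions and $c_\lambda(t)\in\mathbb{Q}[t]$. A sink of an orientation is a vertex with no outgoing edges. If the sinks of $\bar a$ are $s_1<\cdots<s_k$, the $k$ numbers in question are $s_{i+1}-s_i-1$ for $1\le i\le k-1$ together with the single number $(s_1-1)+(n-s_k)$; they are required to equal $\lambda_1-1,\dots,\lambda_k-1$ as a multiset. Example for $n=8$: sinks $2,6,8$ give the numbers $3,1$ and $1+0=1$, corresponding to $\lambda=(4,2,2)$. -}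

module Defs where

open import Data.Bool.Base using (if_then_else_)
open import Data.Fin.Base using (Fin; toℕ; inject₁) renaming (suc to fsuc)
import Data.Fin.Properties as Fin
open import Data.List.Base
  using (List; []; _∷_; _++_; map; foldr; filter; length; concatMap;
         cartesianProductWith; replicate; upTo; allFin)
open import Data.List.Membership.Propositional using (_∈_)
open import Data.List.Membership.Propositional.Properties using (∈-∃++)
import Data.List.Properties as List
import Data.List.Membership.DecPropositional as DecMembership
open import Data.List.Relation.Binary.Permutation.Propositional
  using (_↭_; ↭-refl; ↭-sym; ↭-trans; ↭-prep)
open import Data.List.Relation.Binary.Permutation.Propositional.Properties
  using (shift; drop-∷; ∈-resp-↭; ¬x∷xs↭[])
open import Data.List.Relation.Unary.All using (All; all?; lookup; tabulate)
open import Data.List.Relation.Unary.Any using (here; there)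
open import Data.List.Relation.Unary.Linked using (Linked; linked?)
open import Data.List.Relation.Unary.Unique.Propositional using (Unique; [])
import Data.List.Relation.Unary.Unique.Propositional.Properties as Unique
open import Data.Nat.Base using (ℕ; zero; suc; _+_; _∸_; _≤_; _<_; _≥_)
open import Data.Nat.ListAction using (sum)
import Data.Nat.Properties as ℕ
open import Data.Product using (_×_; _,_; proj₁; proj₂; swap)
open import Data.Product.Properties using (≡-dec)
open import Data.Rational.Base using (ℚ; 0ℚ; 1ℚ) renaming (_+_ to _+ℚ_; _*_ to _*ℚ_)
open import Data.Sum.Base using (_⊎_; inj₁; inj₂)
open import Data.Vec.Base using (Vec; []; _∷_; count; toList)
import Data.Vec.Base as Vec
open import Function.Base using (_∘_)
open import Function.Bundles using (_⇔_; mk⇔; Equivalence)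
open import Relation.Binary.Construct.Closure.ReflexiveTransitive using (Star; ε; _◅_; _◅◅_)
import Relation.Binary.Construct.Closure.ReflexiveTransitive as Star
open import Relation.Binary.Construct.Closure.Transitive using (TransClosure; [_]; _∷_)
open import Relation.Binary.Definitions using (Decidable)
open import Relation.Binary.PropositionalEquality using (_≡_; _≢_; refl; cong)
open import Relation.Nullary using (¬_; Dec; yes; no)
open import Relation.Nullary.Decidable using (does; map′; ¬?; _×-dec_; _⊎-dec_)

------------------------------------------------------------------------
-- ℚ[t]

-- Coefficient lists, lowest degree first.  Trailing zeros are allowed, so
-- equality of polynomials is _≈_, not _≡_.
Poly : Set
Poly = List ℚ

coeff : Poly → ℕ → ℚ
coeff []      _       = 0ℚ
coeff (a ∷ p) zero    = a
coeff (a ∷ p) (suc k) = coeff p k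

infix 4 _≈_
_≈_ : Poly → Poly → Set
p ≈ q = ∀ k → coeff p k ≡ coeff q k

infixl 6 _+ₚ_
_+ₚ_ : Poly → Poly → Poly
[]      +ₚ q       = q
(a ∷ p) +ₚ []      = a ∷ p
(a ∷ p) +ₚ (b ∷ q) = (a +ℚ b) ∷ (p +ₚ q)

infixl 7 _*ₚ_
_*ₚ_ : Poly → Poly → Poly
[]      *ₚ q = []
(a ∷ p) *ₚ q = map (a *ℚ_) q +ₚ (0ℚ ∷ (p *ₚ q))

t^_ : ℕ → Poly
t^ k = replicate k 0ℚ ++ 1ℚ ∷ []

sumₚ : List Poly → Poly
sumₚ = foldr _+ₚ_ []

------------------------------------------------------------------------
-- Formal power series in x₁, x₂, … over ℚ[t]

-- α₁ ∷ … ∷ α_N ∷ [] stands for x₁^α₁ ⋯ x_N^α_N.  A monomial has one such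
-- list for every sufficiently large N; comparing two series at all lists
-- compares them at all monomials.
Monomial : Set
Monomial = List ℕ

Series : Set
Series = Monomial → Poly

infix 4 _≈ₛ_
_≈ₛ_ : Series → Series → Set
F ≈ₛ G = ∀ α → F α ≈ G α

-- All pairs (β , γ) with β γ = α as monomials.
factorizations : Monomial → List (Monomial × Monomial)
factorizations []      = ([] , []) ∷ []
factorizations (a ∷ α) =
  cartesianProductWith (λ { i (β , γ) → (i ∷ β) , (a ∸ i ∷ γ) })
    (upTo (suc a)) (factorizations α)

infixl 7 _*ₛ_
_*ₛ_ : Series → Series → Series
(F *ₛ G) α = sumₚ (map (λ { (β , γ) → F β *ₚ G γ }) (factorizations α))

infixl 7 _·_
_·_ : Poly → Series → Series
(p · F) α = p *ₚ F α

sumₛ : List Series → Series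
sumₛ Fs α = sumₚ (map (λ F → F α) Fs)

-- e_k is the sum of all squarefree monomials of degree k; in particular e 0
-- is the series 1.
e : ℕ → Series
e k α = if does (all? (ℕ._≤? 1) α ×-dec (sum α ℕ.≟ k)) then t^ 0 else []

e[_] : List ℕ → Series
e[ parts ] = foldr (λ k F → e k *ₛ F) (e 0) parts

------------------------------------------------------------------------
-- Partitions

IsPartition : ℕ → List ℕ → Set
IsPartition n parts = Linked _≥_ parts × All (1 ≤_) parts × sum parts ≡ n

isPartition? : ∀ n parts → Dec (IsPartition n parts)
isPartition? n parts =
  linked? ℕ._≥?_ parts ×-dec all? (1 ℕ.≤?_) parts ×-dec (sum parts ℕ.≟ n)

[1⋯_] : ℕ → List ℕ
[1⋯ n ] = map suc (upTo n)

vectors : ∀ {A : Set} → List A → (n : ℕ) → List (Vec A n)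
vectors xs zero    = [] ∷ []
vectors xs (suc n) = cartesianProductWith _∷_ xs (vectors xs n)

-- Every partition of n has at most n parts, each between 1 and n.
partitions : ℕ → List (List ℕ)
partitions n =
  filter (isPartition? n)
    (concatMap (λ k → map toList (vectors [1⋯ n ] k)) (upTo (suc n)))

------------------------------------------------------------------------
-- Digraphs, proper colorings and X

-- The vertices 1, …, n are represented by Fin n, vertex i by the element
-- with toℕ equal to i - 1.
Arc : ℕ → Set
Arc n = Fin n × Fin n

record Digraph (n : ℕ) : Set where
  field
    arcs     : List (Arc n)
    distinct : Unique arcs
open Digraph public

path : ∀ n → Digraph n
path zero = record { arcs = [] ; distinct = [] }
path (suc m) = record
  { arcs     = map step (allFin m)
  ; distinct = Unique.map⁺ (λ eq → Fin.suc-injective (cong proj₂ eq)) (Unique.allFin⁺ m)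
  }
  where
  step : Fin m → Arc (suc m)
  step i = inject₁ i , fsuc i

-- Colors are 1, 2, 3, …
Coloring : ℕ → Set
Coloring n = Vec ℕ n

module _ {n : ℕ} (G : Digraph n) where

  Proper : Coloring n → Set
  Proper κ = All (λ { (u , v) → Vec.lookup κ u ≢ Vec.lookup κ v }) (arcs G)

  proper? : ∀ κ → Dec (Proper κ)
  proper? κ = all? (λ { (u , v) → ¬? (Vec.lookup κ u ℕ.≟ Vec.lookup κ v) }) (arcs G)

  asc : Coloring n → ℕ
  asc κ = length (filter (λ { (u , v) → Vec.lookup κ u ℕ.<? Vec.lookup κ v }) (arcs G))

-- The monomial ∏_v x_{κ(v)}, for a coloring with colors in {1, …, N}.
weight : ∀ {n} (N : ℕ) → Coloring n → Monomial
weight N κ = map (λ i → count (ℕ._≟ i) κ) [1⋯ N ]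

-- The coefficient at α = (α₁, …, α_N) collects t^asc(κ) over the proper κ
-- of weight α.  Such κ use colors in {1, …, N} only: any other color would
-- contribute a variable that does not occur in α.
X : ∀ {n} → Digraph n → Series
X {n} G α =
  sumₚ (map (λ κ → t^ asc G κ)
    (filter (λ κ → proper? G κ ×-dec List.≡-dec ℕ._≟_ (weight N κ) α) (vectors [1⋯ N ] n)))
  where
  N = length α

------------------------------------------------------------------------
-- Acyclic orientations

module _ {n : ℕ} where

  open DecMembership (≡-dec (Fin._≟_ {n}) (Fin._≟_ {n})) public using (_∈?_)

  -- The input pairs are read as unordered edges, and each is given one of its
  -- two directions.  For the arcs of a digraph without loops or antiparallel
  -- arcs, this lists every orientation of the underlying graph exactly once.
  orientations : List (Arc n) → List (List (Arc n))
  orientations []       = [] ∷ []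
  orientations (uv ∷ E) =
    cartesianProductWith _∷_ (uv ∷ swap uv ∷ []) (orientations E)

  _⊢_⟶_ : List (Arc n) → Fin n → Fin n → Set
  a ⊢ u ⟶ v = (u , v) ∈ a

  Acyclic : List (Arc n) → Set
  Acyclic a = ∀ v → ¬ TransClosure (a ⊢_⟶_) v v

  private
    reach-∷ : ∀ x y a {u v} → Star (((x , y) ∷ a) ⊢_⟶_) u v ⇔
              (Star (a ⊢_⟶_) u v ⊎ (Star (a ⊢_⟶_) u x × Star (a ⊢_⟶_) y v))
    reach-∷ x y a = mk⇔ to from
      where
      to : ∀ {u v} → Star (((x , y) ∷ a) ⊢_⟶_) u v →
           Star (a ⊢_⟶_) u v ⊎ (Star (a ⊢_⟶_) u x × Star (a ⊢_⟶_) y v)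
      to ε = inj₁ ε
      to (here refl ◅ w) with to w
      ... | inj₁ r       = inj₂ (ε , r)
      ... | inj₂ (_ , r) = inj₂ (ε , r)
      to (there s ◅ w) with to w
      ... | inj₁ r       = inj₁ (s ◅ r)
      ... | inj₂ (q , r) = inj₂ (s ◅ q , r)

      from : ∀ {u v} → Star (a ⊢_⟶_) u v ⊎ (Star (a ⊢_⟶_) u x × Star (a ⊢_⟶_) y v) →
             Star (((x , y) ∷ a) ⊢_⟶_) u v
      from (inj₁ r)       = Star.map there r
      from (inj₂ (q , r)) = Star.map there q ◅◅ (here refl ◅ Star.map there r)

    reach? : ∀ a → Decidable (Star (a ⊢_⟶_))
    reach? [] u v with u Fin.≟ v
    ... | yes refl = yes ε
    ... | no  u≢v  = no λ { ε → u≢v refl }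
    reach? ((x , y) ∷ a) u v =
      map′ (Equivalence.from (reach-∷ x y a)) (Equivalence.to (reach-∷ x y a))
        (reach? a u v ⊎-dec (reach? a u x ×-dec reach? a y v))

    trans⇒star : ∀ {a : List (Arc n)} {u v} → TransClosure (a ⊢_⟶_) u v → Star (a ⊢_⟶_) u v
    trans⇒star [ s ]   = s ◅ ε
    trans⇒star (s ∷ w) = s ◅ trans⇒star w

    star⇒trans : ∀ {a : List (Arc n)} {u v w} → (u , v) ∈ a → Star (a ⊢_⟶_) v w →
                  TransClosure (a ⊢_⟶_) u w
    star⇒trans s ε       = [ s ]
    star⇒trans s (r ◅ w) = s ∷ star⇒trans r w

  acyclic? : ∀ a → Dec (Acyclic a)
  acyclic? a = map′ sound complete (all? (λ { (u , v) → ¬? (reach? a v u) }) a)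
    where
    NoReturn : Arc n → Set
    NoReturn (u , v) = ¬ Star (a ⊢_⟶_) v u

    sound : All NoReturn a → Acyclic a
    sound h v [ s ]   = lookup h s ε
    sound h v (s ∷ w) = lookup h s (trans⇒star w)

    complete : Acyclic a → All NoReturn a
    complete h = tabulate λ {uv} s w → h (proj₁ uv) (star⇒trans s w)

  Sink : List (Arc n) → Fin n → Set
  Sink a s = All (λ uv → proj₁ uv ≢ s) a

  sink? : ∀ a s → Dec (Sink a s)
  sink? a s = all? (λ uv → ¬? (proj₁ uv Fin.≟ s)) a

  -- In increasing order, as numbers in {1, …, n}.
  sinks : List (Arc n) → List ℕ
  sinks a = map (suc ∘ toℕ) (filter (sink? a) (allFin n))

  -- The number of edges on which the orientation a agrees with G.
  ascₒ : Digraph n → List (Arc n) → ℕ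
  ascₒ G a = length (filter (_∈? a) (arcs G))

-- s₂ - s₁ - 1, …, s_k - s_{k-1} - 1
between : List ℕ → List ℕ
between []           = []
between (s ∷ [])     = []
between (s ∷ r ∷ ss) = (r ∸ s ∸ 1) ∷ between (r ∷ ss)

last : ℕ → List ℕ → ℕ
last s []       = s
last s (r ∷ ss) = last r ss

-- The k numbers attached to sinks s₁ < … < s_k among 1, …, n.  The empty
-- case is irrelevant: an acyclic orientation on n ≥ 1 vertices has a sink.
gaps : ℕ → List ℕ → List ℕ
gaps n []       = []
gaps n (s ∷ ss) = ((s ∸ 1) + (n ∸ last s ss)) ∷ between (s ∷ ss)

infix 4 _↭?_
_↭?_ : Decidable (_↭_ {A = ℕ})
[]       ↭? []       = yes ↭-refl
[]       ↭? (y ∷ ys) = no (¬x∷xs↭[] ∘ ↭-sym)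
(x ∷ xs) ↭? ys with DecMembership._∈?_ ℕ._≟_ x ys
... | no  x∉ys = no λ p → x∉ys (∈-resp-↭ p (here refl))
... | yes x∈ys with ∈-∃++ x∈ys
...   | as , bs , refl =
        map′ (λ p → ↭-trans (↭-prep x p) (↭-sym (shift x as bs)))
             (λ p → drop-∷ (↭-trans p (shift x as bs)))
             (xs ↭? as ++ bs)

InAO : ∀ {n} → List ℕ → List (Arc n) → Set
InAO {n} parts a = Acyclic a × gaps n (sinks a) ↭ map (_∸ 1) parts

inAO? : ∀ {n} parts (a : List (Arc n)) → Dec (InAO parts a)
inAO? {n} parts a = acyclic? a ×-dec (gaps n (sinks a) ↭? map (_∸ 1) parts)

-- AO_λ of the underlying undirected graph of G.
AO : ∀ {n} → Digraph n → List ℕ → List (List (Arc n))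
AO G parts = filter (inAO? parts) (orientations (arcs G))

{-# OPTIONS --safe #-}
-- Let W_n = Σ t^asc x^w over the words w of length n + 1 without two equal
-- adjacent letters, and W_{n,c} its part with first letter c.  Removing the
-- first letter gives W_{n+1,c} = x_c (t Σ_{d>c} W_{n,d} + Σ_{d<c} W_{n,d}), and
-- this linear system is solved by
--   W_{n,c} = N_c + Σ_{j+m+1=n} t [j]_t e_{j+1} W_{m,c},
-- where N_c collects x_c ∏_{d<c} (1 + x_d) ∏_{d>c} (1 + t x_d) in degree n + 1.
-- Since Σ_c N_c = [n+1]_t e_{n+1}, summing over c gives
--   W_n = [n+1]_t e_{n+1} + Σ_{j+m+1=n} t [j]_t e_{j+1} W_m.
-- Reading an orientation of the path from left to right, a gap of j ≥ 1
-- vertices between two sinks contributes t [j]_t e_{j+1}, so that the generating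
-- series of the orientations satisfies the same recurrence.  The e_λ are
-- linearly independent because the lexicographically largest monomial of e_λ
-- is x^{λ'}, with coefficient 1.
module Submission where

open import Defs
open import Algebra.Bundles using (CommutativeMonoid)
import Algebra.Definitions as Algebra
import Algebra.Properties.CommutativeSemigroup as CommutativeSemigroup
import Algebra.Properties.Group as Group
open import Data.Bool.Base using (Bool; true; false; if_then_else_; _∧_)
open import Data.Bool.Properties using (∧-zeroʳ)
open import Data.Fin.Base as Fin using (Fin; toℕ)
import Data.Fin.Properties as Fin
open import Data.List.Base
  using (List; []; _∷_; _++_; map; foldr; filter; length; concatMap;
         cartesianProductWith; upTo; applyUpTo; allFin)
open import Data.List.Membership.Propositional using (_∈_; lose)
open import Data.List.Membership.Propositional.Properties
  using (∈-map⁺; ∈-map⁻; ∈-filter⁺; ∈-concatMap⁺; ∈-cartesianProductWith⁺; ∈-upTo⁺; ∈-upTo⁻)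
import Data.List.Properties as List
open import Data.List.Relation.Binary.Equality.Propositional using (≋⇒≡)
open import Data.List.Relation.Binary.Lex.Core using (Lex-≤; this; next)
import Data.List.Relation.Binary.Lex.Strict as Lex
open import Data.List.Relation.Binary.Permutation.Propositional as ↭
  using (_↭_; ↭-sym; ↭-trans; ↭-reflexive; ↭⇒↭ₛ)
open import Data.List.Relation.Binary.Permutation.Propositional.Properties
  using (All-resp-↭; ∈-resp-↭; map⁺)
import Data.List.Relation.Binary.Permutation.Setoid.Properties as ↭ₛ
open import Data.List.Relation.Unary.All as All using (All; []; _∷_; all?)
import Data.List.Relation.Unary.All.Properties as All
open import Data.List.Relation.Unary.AllPairs as AllPairs using (AllPairs; []; _∷_)
import Data.List.Relation.Unary.AllPairs.Properties as AllPairs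
open import Data.List.Relation.Unary.Any using (here; there)
open import Data.List.Relation.Unary.Linked as Linked using (Linked; [-]; _∷_)
import Data.List.Relation.Unary.Linked.Properties as Linked
open import Data.List.Relation.Unary.Sorted.TotalOrder.Properties using (↗↭↗⇒≋)
open import Data.List.Relation.Unary.Unique.Propositional using (Unique)
import Data.List.Relation.Unary.Unique.Propositional.Properties as Unique
import Data.List.Sort as Sort
open import Data.Nat.Base
  using (ℕ; zero; suc; _+_; _∸_; pred; _≤_; _<_; _≥_; z≤n; s≤s; z<s; s<s)
open import Data.Nat.Induction using (<-rec)
open import Data.Nat.ListAction using (sum)
open import Data.Nat.ListAction.Properties using (sum-↭)
import Data.Nat.Properties as ℕ
open import Data.Product.Base as Product using (_×_; _,_; proj₁; proj₂; map₁; swap; uncurry)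
open import Data.Rational.Base using (0ℚ; 1ℚ) renaming (_+_ to _+ℚ_; _*_ to _*ℚ_)
import Data.Rational.Properties as ℚ
open import Data.Unit.Base using (⊤; tt)
open import Data.Vec.Base as Vec using (Vec; []; _∷_; count; toList; fromList)
import Data.Vec.Properties as Vec
open import Function.Base using (_∘_; id)
open import Function.Bundles using (_⇔_; mk⇔; Equivalence)
open import Level using (0ℓ)
open import Relation.Binary.Bundles using (DecTotalOrder)
open import Relation.Binary.Construct.Closure.Transitive using (TransClosure; [_]; _∷_)
import Relation.Binary.Construct.Flip.EqAndOrd as Flip
import Relation.Binary.Construct.On as On
open import Relation.Binary.Definitions using (tri<; tri≈; tri>)
open import Relation.Binary.PropositionalEquality as ≡
  using (_≡_; _≢_; refl; cong; cong₂; module ≡-Reasoning)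
import Relation.Binary.Reasoning.Setoid as SetoidReasoning
open import Relation.Nullary using (Dec; yes; ¬_; contradiction)
open import Relation.Nullary.Decidable using (does; does-⇔; dec-true; dec-false; _×-dec_; ¬?)
open import Relation.Unary using (_≐_)

-- The identities for N_c behind the recurrence could be checked by telescoping sums and dividing by
-- 1 - t. Here they are arranged without subtraction and proved by isolating the variable x₁, so
-- that only addition and the operator t occur. The coefficients therefore form an arbitrary
-- commutative monoid with an additive map t, and multiplication by e_k or x_c is an operator on
-- series, given by recursion on the exponents. Cancellation of coefficients enters only in the
-- independence of the e_λ. Two features of the setting shape the statements: N_c is inhomogeneous,
-- so the equations for words are compared at exponent lists of one fixed degree; and the letters
-- available at an exponent list are bounded by its length, so every sum over letters depends on the
-- number of variables. Both pieces of data are carried through the operators.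

private
  module ℕ-+ = CommutativeSemigroup ℕ.+-commutativeSemigroup

-- The pairs (i , j) with i + j + 1 = n.
antidiagonal : ℕ → List (ℕ × ℕ)
antidiagonal zero    = []
antidiagonal (suc n) = (0 , n) ∷ map (map₁ suc) (antidiagonal n)

-- Finite sums, series and multiplication operators over a commutative monoid

module SeriesOver (M : CommutativeMonoid 0ℓ 0ℓ) where

  open CommutativeMonoid M public
    renaming (Carrier to A; _≈_ to _≃_; _∙_ to _⊕_; ε to 𝟎; ∙-cong to ⊕-cong;
              ∙-congˡ to ⊕-congˡ; ∙-congʳ to ⊕-congʳ; assoc to ⊕-assoc; comm to ⊕-comm;
              identityˡ to ⊕-identityˡ; identityʳ to ⊕-identityʳ;
              refl to ≃-refl; sym to ≃-sym; trans to ≃-trans; reflexive to ≃-reflexive)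
    using (setoid; commutativeSemigroup)
  open CommutativeSemigroup commutativeSemigroup public
    using (interchange; x∙yz≈y∙xz; xy∙z≈xz∙y)
  open SetoidReasoning setoid public

  -- Takes the place of scalar multiplication: t, its powers, [m]_t, the transition weights of words
  -- and multiplication by a fixed polynomial are all instances.
  record Additive (f : A → A) : Set where
    field
      f-cong : ∀ {a b} → a ≃ b → f a ≃ f b
      f-⊕    : ∀ a b → f (a ⊕ b) ≃ f a ⊕ f b
      f-𝟎    : f 𝟎 ≃ 𝟎
  open Additive public

  id-additive : Additive id
  id-additive = record { f-cong = id ; f-⊕ = λ _ _ → ≃-refl ; f-𝟎 = ≃-refl }

  𝟎-additive : Additive (λ _ → 𝟎)
  𝟎-additive = record
    { f-cong = λ _ → ≃-refl ; f-⊕ = λ _ _ → ≃-sym (⊕-identityˡ 𝟎) ; f-𝟎 = ≃-refl }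

  ∘-additive : ∀ {f g} → Additive f → Additive g → Additive (f ∘ g)
  ∘-additive F G = record
    { f-cong = f-cong F ∘ f-cong G
    ; f-⊕    = λ a b → ≃-trans (f-cong F (f-⊕ G a b)) (f-⊕ F _ _)
    ; f-𝟎    = ≃-trans (f-cong F (f-𝟎 G)) (f-𝟎 F) }

  ⊕-additive : ∀ {f g} → Additive f → Additive g → Additive (λ a → f a ⊕ g a)
  ⊕-additive F G = record
    { f-cong = λ a≃b → ⊕-cong (f-cong F a≃b) (f-cong G a≃b)
    ; f-⊕    = λ a b → ≃-trans (⊕-cong (f-⊕ F a b) (f-⊕ G a b)) (interchange _ _ _ _)
    ; f-𝟎    = ≃-trans (⊕-cong (f-𝟎 F) (f-𝟎 G)) (⊕-identityˡ 𝟎) }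

  -- Finite sums

  ∑ : {I : Set} → List I → (I → A) → A
  ∑ xs f = foldr (λ x a → f x ⊕ a) 𝟎 xs

  module _ {I : Set} where

    ∑-cong-∈ : ∀ (xs : List I) {f g} → (∀ x → x ∈ xs → f x ≃ g x) → ∑ xs f ≃ ∑ xs g
    ∑-cong-∈ []       h = ≃-refl
    ∑-cong-∈ (x ∷ xs) h = ⊕-cong (h x (here refl)) (∑-cong-∈ xs (λ y → h y ∘ there))

    ∑-cong : ∀ (xs : List I) {f g} → (∀ x → f x ≃ g x) → ∑ xs f ≃ ∑ xs g
    ∑-cong xs h = ∑-cong-∈ xs (λ x _ → h x)

    ∑-𝟎 : ∀ (xs : List I) → ∑ xs (λ _ → 𝟎) ≃ 𝟎
    ∑-𝟎 []       = ≃-refl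
    ∑-𝟎 (x ∷ xs) = ≃-trans (⊕-identityˡ _) (∑-𝟎 xs)

    ∑-⊕ : ∀ (xs : List I) {f g} → ∑ xs (λ x → f x ⊕ g x) ≃ ∑ xs f ⊕ ∑ xs g
    ∑-⊕ []       = ≃-sym (⊕-identityˡ 𝟎)
    ∑-⊕ (x ∷ xs) = ≃-trans (⊕-congˡ (∑-⊕ xs)) (interchange _ _ _ _)

    ∑-++ : ∀ (xs ys : List I) {f} → ∑ (xs ++ ys) f ≃ ∑ xs f ⊕ ∑ ys f
    ∑-++ []       ys = ≃-sym (⊕-identityˡ _)
    ∑-++ (x ∷ xs) ys = ≃-trans (⊕-congˡ (∑-++ xs ys)) (≃-sym (⊕-assoc _ _ _))

    ∑-↭ : ∀ {xs ys : List I} {f} → xs ↭ ys → ∑ xs f ≃ ∑ ys f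
    ∑-↭ ↭.refl          = ≃-refl
    ∑-↭ (↭.prep x p)    = ⊕-congˡ (∑-↭ p)
    ∑-↭ (↭.swap x y p)  = ≃-trans (⊕-congˡ (⊕-congˡ (∑-↭ p))) (x∙yz≈y∙xz _ _ _)
    ∑-↭ (↭.trans p q)   = ≃-trans (∑-↭ p) (∑-↭ q)

    ∑-single : ∀ {xs : List I} {x f} → Unique xs → x ∈ xs →
               (∀ y → y ∈ xs → y ≢ x → f y ≃ 𝟎) → ∑ xs f ≃ f x
    ∑-single {x ∷ xs} (x∉xs ∷ _)  (here refl)  h = ≃-trans (⊕-congˡ (≃-trans
      (∑-cong-∈ xs (λ y y∈xs → h y (there y∈xs) (≡.≢-sym (All.lookup x∉xs y∈xs)))) (∑-𝟎 xs)))
      (⊕-identityʳ _)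
    ∑-single {y ∷ xs} (y∉xs ∷ xs!) (there x∈xs) h = ≃-trans
      (⊕-cong (h y (here refl) (All.lookup y∉xs x∈xs)) (∑-single xs! x∈xs (λ z → h z ∘ there)))
      (⊕-identityˡ _)

    ∑-additive : ∀ (xs : List I) {f : A → A} → Additive f → ∀ {g} → f (∑ xs g) ≃ ∑ xs (f ∘ g)
    ∑-additive []       F = f-𝟎 F
    ∑-additive (x ∷ xs) F = ≃-trans (f-⊕ F _ _) (⊕-congˡ (∑-additive xs F))

    ∑-filter : ∀ {P : I → Set} (P? : ∀ x → Dec (P x)) xs {f} →
               ∑ (filter P? xs) f ≃ ∑ xs (λ x → if does (P? x) then f x else 𝟎)
    ∑-filter P? []       = ≃-refl
    ∑-filter P? (x ∷ xs) with does (P? x)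
    ... | true  = ⊕-congˡ (∑-filter P? xs)
    ... | false = ≃-trans (∑-filter P? xs) (≃-sym (⊕-identityˡ _))

    ∑-map : ∀ {J : Set} (h : J → I) xs {f} → ∑ (map h xs) f ≃ ∑ xs (f ∘ h)
    ∑-map h []       = ≃-refl
    ∑-map h (x ∷ xs) = ⊕-congˡ (∑-map h xs)

  ∑-comm : ∀ {I J : Set} (xs : List I) (ys : List J) (f : I → J → A) →
           ∑ xs (λ x → ∑ ys (f x)) ≃ ∑ ys (λ y → ∑ xs (λ x → f x y))
  ∑-comm []       ys f = ≃-sym (∑-𝟎 ys)
  ∑-comm (x ∷ xs) ys f = ≃-trans (⊕-congˡ (∑-comm xs ys f)) (≃-sym (∑-⊕ ys))

  ∑-cartesianProductWith : ∀ {I J K : Set} (h : I → J → K) xs ys {f} →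
    ∑ (cartesianProductWith h xs ys) f ≃ ∑ xs (λ x → ∑ ys (λ y → f (h x y)))
  ∑-cartesianProductWith h []       ys = ≃-refl
  ∑-cartesianProductWith h (x ∷ xs) ys = ≃-trans (∑-++ (map (h x) ys) _)
    (⊕-cong (∑-map (h x) ys) (∑-cartesianProductWith h xs ys))

  ∑-upTo-suc : ∀ n {f} → ∑ (upTo (suc n)) f ≃ f 0 ⊕ ∑ (upTo n) (f ∘ suc)
  ∑-upTo-suc n {f} = ⊕-congˡ (≃-trans
    (≃-reflexive (cong (λ xs → ∑ xs f) (≡.sym (List.map-applyUpTo id suc n)))) (∑-map suc (upTo n)))

  ∑-upTo-suc² : ∀ n {f} → ∑ (upTo (suc (suc n))) f ≃ f 0 ⊕ (f 1 ⊕ ∑ (upTo n) (f ∘ suc ∘ suc))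
  ∑-upTo-suc² n = ≃-trans (∑-upTo-suc (suc n)) (⊕-congˡ (∑-upTo-suc n))

  ∑⋄ : ℕ → (ℕ → ℕ → A) → A
  ∑⋄ n f = ∑ (antidiagonal n) (uncurry f)

  ∑⋄-suc : ∀ n f → ∑⋄ (suc n) f ≃ f 0 n ⊕ ∑⋄ n (f ∘ suc)
  ∑⋄-suc n f = ⊕-congˡ (∑-map (map₁ suc) (antidiagonal n))

  -- `antidiagonal` recurses on the first index; this is the matching recursion on the second one,
  -- which splits off the pair with j = 0.
  ∑⋄-last : ∀ n f → ∑⋄ (suc n) f ≃ ∑⋄ n (λ i j → f i (suc j)) ⊕ f n 0
  ∑⋄-last zero    f = ⊕-comm _ _
  ∑⋄-last (suc n) f = begin
    ∑⋄ (suc (suc n)) f                                             ≈⟨ ∑⋄-suc (suc n) f ⟩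
    f 0 (suc n) ⊕ ∑⋄ (suc n) (f ∘ suc)                             ≈⟨ ⊕-congˡ (∑⋄-last n (f ∘ suc)) ⟩
    f 0 (suc n) ⊕ (∑⋄ n (λ i j → f (suc i) (suc j)) ⊕ f (suc n) 0) ≈⟨ ⊕-assoc _ _ _ ⟨
    f 0 (suc n) ⊕ ∑⋄ n (λ i j → f (suc i) (suc j)) ⊕ f (suc n) 0   ≈⟨ ⊕-congʳ (∑⋄-suc n _) ⟨
    ∑⋄ (suc n) (λ i j → f i (suc j)) ⊕ f (suc n) 0                 ∎

  ∑⋄-cong : ∀ n {f g} → (∀ i j → suc (i + j) ≡ n → f i j ≃ g i j) → ∑⋄ n f ≃ ∑⋄ n g
  ∑⋄-cong zero    h = ≃-refl
  ∑⋄-cong (suc n) {f} {g} h = begin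
    ∑⋄ (suc n) f           ≈⟨ ∑⋄-suc n f ⟩
    f 0 n ⊕ ∑⋄ n (f ∘ suc) ≈⟨ ⊕-cong (h 0 n refl) (∑⋄-cong n (λ i j eq → h (suc i) j (cong suc eq))) ⟩
    g 0 n ⊕ ∑⋄ n (g ∘ suc) ≈⟨ ∑⋄-suc n g ⟨
    ∑⋄ (suc n) g           ∎

  -- Both sides run over the triples with i + j + l + 2 = n. It later exchanges the number of
  -- vertices before the first sink with the gap after it.
  ∑⋄-assoc : ∀ n (f : ℕ → ℕ → ℕ → A) →
    ∑⋄ n (λ i m → ∑⋄ m (f i)) ≃ ∑⋄ n (λ j m → ∑⋄ m (λ i l → f i j l))
  ∑⋄-assoc zero    f = ≃-refl
  ∑⋄-assoc (suc n) f = begin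
    ∑⋄ (suc n) (λ i m → ∑⋄ m (f i))
      ≈⟨ ∑⋄-suc n _ ⟩
    ∑⋄ n (f 0) ⊕ ∑⋄ n (λ i m → ∑⋄ m (f (suc i)))
      ≈⟨ ⊕-congˡ (∑⋄-assoc n (f ∘ suc)) ⟩
    ∑⋄ n (f 0) ⊕ ∑⋄ n (λ j m → ∑⋄ m (λ i l → f (suc i) j l))
      ≈⟨ ∑-⊕ (antidiagonal n) ⟨
    ∑⋄ n (λ j m → f 0 j m ⊕ ∑⋄ m (λ i l → f (suc i) j l))
      ≈⟨ ∑⋄-cong n (λ j m _ → ≃-sym (∑⋄-suc m _)) ⟩
    ∑⋄ n (λ j m → ∑⋄ (suc m) (λ i l → f i j l))
      ≈⟨ ⊕-identityʳ _ ⟨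
    ∑⋄ n (λ j m → ∑⋄ (suc m) (λ i l → f i j l)) ⊕ 𝟎
      ≈⟨ ∑⋄-last n _ ⟨
    ∑⋄ (suc n) (λ j m → ∑⋄ m (λ i l → f i j l)) ∎

  -- Series with coefficients in A

  Ser : Set
  Ser = List ℕ → A

  record Linear (Φ : Ser → A) : Set where
    field
      Φ-cong : ∀ {G H} → (∀ β → G β ≃ H β) → Φ G ≃ Φ H
      Φ-⊕    : ∀ G H → Φ (λ β → G β ⊕ H β) ≃ Φ G ⊕ Φ H
      Φ-𝟎    : Φ (λ _ → 𝟎) ≃ 𝟎
  open Linear public

  ∑-linear : ∀ {Φ} → Linear Φ → ∀ {I : Set} (xs : List I) (G : I → Ser) →
             Φ (λ β → ∑ xs (λ x → G x β)) ≃ ∑ xs (λ x → Φ (G x))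
  ∑-linear L []       G = Φ-𝟎 L
  ∑-linear L (x ∷ xs) G = ≃-trans (Φ-⊕ L _ _) (⊕-congˡ (∑-linear L xs G))

  const : A → Ser
  const a []          = a
  const a (zero ∷ α)  = const a α
  const a (suc _ ∷ α) = 𝟎

  const-cong : ∀ {a b} → a ≃ b → ∀ α → const a α ≃ const b α
  const-cong a≃b []          = a≃b
  const-cong a≃b (zero ∷ α)  = const-cong a≃b α
  const-cong a≃b (suc _ ∷ α) = ≃-refl

  const-additive : ∀ {f} → Additive f → ∀ {a} α → const (f a) α ≃ f (const a α)
  const-additive F []          = ≃-refl
  const-additive F (zero ∷ α)  = const-additive F α
  const-additive F (suc _ ∷ α) = ≃-sym (f-𝟎 F)

  -- Multiplication by e_k: isolating the first variable, e_k becomes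
  -- e_k + x₁ e_{k-1} in the remaining ones.
  mulE : ℕ → Ser → Ser
  mulE zero    G α           = G α
  mulE (suc k) G []          = 𝟎
  mulE (suc k) G (zero ∷ α)  = mulE (suc k) (λ β → G (zero ∷ β)) α
  mulE (suc k) G (suc a ∷ α) =
    mulE (suc k) (λ β → G (suc a ∷ β)) α ⊕ mulE k (λ β → G (a ∷ β)) α

  -- Removing a monomial of e_k lowers the degree by k and keeps the number of variables. This makes
  -- equations available under the product that hold only in one degree, and lets sums over letters
  -- bounded by `length α` be rewritten there.
  mulE-cong-deg : ∀ k α {G H} →
    (∀ β → length β ≡ length α → k + sum β ≡ sum α → G β ≃ H β) → mulE k G α ≃ mulE k H α
  mulE-cong-deg zero    α           h = h α refl refl
  mulE-cong-deg (suc k) []          h = ≃-refl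
  mulE-cong-deg (suc k) (zero ∷ α)  h =
    mulE-cong-deg (suc k) α (λ β eq → h (zero ∷ β) (cong suc eq))
  mulE-cong-deg (suc k) (suc a ∷ α) h = ⊕-cong
    (mulE-cong-deg (suc k) α λ β eq s → h (suc a ∷ β) (cong suc eq)
      (≡.trans (ℕ-+.x∙yz≈y∙xz (suc k) (suc a) (sum β)) (cong (suc a +_) s)))
    (mulE-cong-deg k α λ β eq s → h (a ∷ β) (cong suc eq)
      (cong suc (≡.trans (ℕ-+.x∙yz≈y∙xz k a (sum β)) (cong (a +_) s))))

  mulE-cong : ∀ k α {G H} → (∀ β → G β ≃ H β) → mulE k G α ≃ mulE k H α
  mulE-cong k α h = mulE-cong-deg k α (λ β _ _ → h β)

  mulE-⊕ : ∀ k α {G H} → mulE k (λ β → G β ⊕ H β) α ≃ mulE k G α ⊕ mulE k H α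
  mulE-⊕ zero    α           = ≃-refl
  mulE-⊕ (suc k) []          = ≃-sym (⊕-identityˡ 𝟎)
  mulE-⊕ (suc k) (zero ∷ α)  = mulE-⊕ (suc k) α
  mulE-⊕ (suc k) (suc a ∷ α) =
    ≃-trans (⊕-cong (mulE-⊕ (suc k) α) (mulE-⊕ k α)) (interchange _ _ _ _)

  mulE-additive : ∀ {f} → Additive f → ∀ k α {G} → mulE k (f ∘ G) α ≃ f (mulE k G α)
  mulE-additive F zero    α           = ≃-refl
  mulE-additive F (suc k) []          = ≃-sym (f-𝟎 F)
  mulE-additive F (suc k) (zero ∷ α)  = mulE-additive F (suc k) α
  mulE-additive F (suc k) (suc a ∷ α) =
    ≃-trans (⊕-cong (mulE-additive F (suc k) α) (mulE-additive F k α)) (≃-sym (f-⊕ F _ _))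

  mulE-𝟎 : ∀ k α → mulE k (λ _ → 𝟎) α ≃ 𝟎
  mulE-𝟎 k α = mulE-additive 𝟎-additive k α {λ _ → 𝟎}

  mulE-linear : ∀ k α → Linear (λ G → mulE k G α)
  mulE-linear k α = record
    { Φ-cong = mulE-cong k α ; Φ-⊕ = λ _ _ → mulE-⊕ k α ; Φ-𝟎 = mulE-𝟎 k α }

  mulE-comm : ∀ j k α {G} → mulE j (mulE k G) α ≃ mulE k (mulE j G) α
  mulE-comm zero    k       α                     = ≃-refl
  mulE-comm (suc j) zero    α                     = ≃-refl
  mulE-comm (suc j) (suc k) []                    = ≃-refl
  mulE-comm (suc j) (suc k) (zero ∷ α)            = mulE-comm (suc j) (suc k) α
  -- With exponent 1 only one of the two factors can contain x₁; from exponent 2 on, both can.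
  mulE-comm (suc j) (suc k) (suc zero ∷ α)        = begin
    mulE (suc j) (λ β → mulE (suc k) _ β ⊕ mulE k _ β) α ⊕ mulE j (mulE (suc k) _) α
      ≈⟨ ⊕-congʳ (mulE-⊕ (suc j) α) ⟩
    mulE (suc j) (mulE (suc k) _) α ⊕ mulE (suc j) (mulE k _) α ⊕ mulE j (mulE (suc k) _) α
      ≈⟨ ⊕-cong (⊕-cong (mulE-comm (suc j) (suc k) α) (mulE-comm (suc j) k α)) (mulE-comm j (suc k) α) ⟩
    mulE (suc k) (mulE (suc j) _) α ⊕ mulE k (mulE (suc j) _) α ⊕ mulE (suc k) (mulE j _) α
      ≈⟨ xy∙z≈xz∙y _ _ _ ⟩
    mulE (suc k) (mulE (suc j) _) α ⊕ mulE (suc k) (mulE j _) α ⊕ mulE k (mulE (suc j) _) α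
      ≈⟨ ⊕-congʳ (mulE-⊕ (suc k) α) ⟨
    mulE (suc k) (λ β → mulE (suc j) _ β ⊕ mulE j _ β) α ⊕ mulE k (mulE (suc j) _) α ∎
  mulE-comm (suc j) (suc k) (suc (suc a) ∷ α)     = begin
    mulE (suc j) (λ β → mulE (suc k) _ β ⊕ mulE k _ β) α ⊕ mulE j (λ β → mulE (suc k) _ β ⊕ mulE k _ β) α
      ≈⟨ ⊕-cong (mulE-⊕ (suc j) α) (mulE-⊕ j α) ⟩
    mulE (suc j) (mulE (suc k) _) α ⊕ mulE (suc j) (mulE k _) α ⊕ (mulE j (mulE (suc k) _) α ⊕ mulE j (mulE k _) α)
      ≈⟨ ⊕-cong (⊕-cong (mulE-comm (suc j) (suc k) α) (mulE-comm (suc j) k α))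
                (⊕-cong (mulE-comm j (suc k) α) (mulE-comm j k α)) ⟩
    mulE (suc k) (mulE (suc j) _) α ⊕ mulE k (mulE (suc j) _) α ⊕ (mulE (suc k) (mulE j _) α ⊕ mulE k (mulE j _) α)
      ≈⟨ interchange _ _ _ _ ⟩
    mulE (suc k) (mulE (suc j) _) α ⊕ mulE (suc k) (mulE j _) α ⊕ (mulE k (mulE (suc j) _) α ⊕ mulE k (mulE j _) α)
      ≈⟨ ⊕-cong (mulE-⊕ (suc k) α) (mulE-⊕ k α) ⟨
    mulE (suc k) (λ β → mulE (suc j) _ β ⊕ mulE j _ β) α ⊕ mulE k (λ β → mulE (suc j) _ β ⊕ mulE j _ β) α ∎

  mulEs : List ℕ → Ser → Ser
  mulEs ks G = foldr mulE G ks

  mulEs-cong : ∀ ks {G H} → (∀ β → G β ≃ H β) → ∀ α → mulEs ks G α ≃ mulEs ks H α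
  mulEs-cong []       h α = h α
  mulEs-cong (k ∷ ks) h α = mulE-cong k α (mulEs-cong ks h)

  mulEs-additive : ∀ {f} → Additive f → ∀ ks {G} α → mulEs ks (f ∘ G) α ≃ f (mulEs ks G α)
  mulEs-additive F []       α = ≃-refl
  mulEs-additive F (k ∷ ks) α =
    ≃-trans (mulE-cong k α (mulEs-additive F ks)) (mulE-additive F k α)

  mulEs-↭ : ∀ {js ks G} → js ↭ ks → ∀ α → mulEs js G α ≃ mulEs ks G α
  mulEs-↭ ↭.refl         α = ≃-refl
  mulEs-↭ (↭.prep k p)   α = mulE-cong k α (mulEs-↭ p)
  mulEs-↭ {G = G} (↭.swap {xs} {ys} j k p) α = ≃-trans
    (mulE-cong j α (λ β → mulE-cong k β (mulEs-↭ p))) (mulE-comm j k α {mulEs ys G})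
  mulEs-↭ (↭.trans p q)  α = ≃-trans (mulEs-↭ p α) (mulEs-↭ q α)

  mulEs-const-additive : ∀ ks α → Additive (λ a → mulEs ks (const a) α)
  mulEs-const-additive ks α = record
    { f-cong = λ a≃b → mulEs-cong ks (const-cong a≃b) α
    ; f-⊕    = λ a b → ≃-trans (mulEs-cong ks (const-⊕ a b) α) (mulEs-⊕ ks α)
    ; f-𝟎    = ≃-trans (mulEs-cong ks (const-additive 𝟎-additive {𝟎}) α)
        (mulEs-additive 𝟎-additive ks {const 𝟎} α) }
    where
    const-⊕ : ∀ a b β → const (a ⊕ b) β ≃ const a β ⊕ const b β
    const-⊕ a b []          = ≃-refl
    const-⊕ a b (zero ∷ β)  = const-⊕ a b β
    const-⊕ a b (suc _ ∷ β) = ≃-sym (⊕-identityˡ 𝟎)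

    mulEs-⊕ : ∀ ks {G H} α → mulEs ks (λ β → G β ⊕ H β) α ≃ mulEs ks G α ⊕ mulEs ks H α
    mulEs-⊕ []       α = ≃-refl
    mulEs-⊕ (k ∷ ks) α = ≃-trans (mulE-cong k α (mulEs-⊕ ks)) (mulE-⊕ k α)

  -- Multiplication by x_{c+1}
  mulX : ℕ → Ser → Ser
  mulX c       G []          = 𝟎
  mulX zero    G (zero ∷ α)  = 𝟎
  mulX zero    G (suc a ∷ α) = G (a ∷ α)
  mulX (suc c) G (a ∷ α)     = mulX c (λ β → G (a ∷ β)) α

  -- The variable x_{c+1} divides a monomial only if it is among the listed variables, which is why
  -- the argument may assume `c < length β`.
  mulX-cong-deg : ∀ c α {G H} →
    (∀ β → c < length β → length β ≡ length α → suc (sum β) ≡ sum α → G β ≃ H β) →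
    mulX c G α ≃ mulX c H α
  mulX-cong-deg c       []          h = ≃-refl
  mulX-cong-deg zero    (zero ∷ α)  h = ≃-refl
  mulX-cong-deg zero    (suc a ∷ α) h = h (a ∷ α) (s≤s z≤n) refl refl
  mulX-cong-deg (suc c) (a ∷ α)     h = mulX-cong-deg c α λ β c<l eq s →
    h (a ∷ β) (s≤s c<l) (cong suc eq) (≡.trans (≡.sym (ℕ.+-suc a (sum β))) (cong (a +_) s))

  mulX-⊕ : ∀ c α {G H} → mulX c (λ β → G β ⊕ H β) α ≃ mulX c G α ⊕ mulX c H α
  mulX-⊕ c       []          = ≃-sym (⊕-identityˡ 𝟎)
  mulX-⊕ zero    (zero ∷ α)  = ≃-sym (⊕-identityˡ 𝟎)
  mulX-⊕ zero    (suc a ∷ α) = ≃-refl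
  mulX-⊕ (suc c) (a ∷ α)     = mulX-⊕ c α

  mulX-additive : ∀ {f} → Additive f → ∀ c α {G} → mulX c (f ∘ G) α ≃ f (mulX c G α)
  mulX-additive F c       []          = ≃-sym (f-𝟎 F)
  mulX-additive F zero    (zero ∷ α)  = ≃-sym (f-𝟎 F)
  mulX-additive F zero    (suc a ∷ α) = ≃-refl
  mulX-additive F (suc c) (a ∷ α)     = mulX-additive F c α

  mulX-𝟎 : ∀ c α → mulX c (λ _ → 𝟎) α ≃ 𝟎
  mulX-𝟎 c α = mulX-additive 𝟎-additive c α {λ _ → 𝟎}

  mulX-linear : ∀ c α → Linear (λ G → mulX c G α)
  mulX-linear c α = record
    { Φ-cong = λ h → mulX-cong-deg c α (λ β _ _ _ → h β) ; Φ-⊕ = λ _ _ → mulX-⊕ c α ; Φ-𝟎 = mulX-𝟎 c α }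

  mulE-mulX : ∀ k c α {G} → mulE k (mulX c G) α ≃ mulX c (mulE k G) α
  mulE-mulX zero    c       α                 = ≃-refl
  mulE-mulX (suc k) c       []                = ≃-refl
  mulE-mulX (suc k) zero    (zero ∷ α)        = mulE-𝟎 (suc k) α
  mulE-mulX (suc k) zero    (suc zero ∷ α)    = ≃-trans (⊕-congˡ (mulE-𝟎 k α)) (⊕-identityʳ _)
  mulE-mulX (suc k) zero    (suc (suc a) ∷ α) = ≃-refl
  mulE-mulX (suc k) (suc c) (zero ∷ α)        = mulE-mulX (suc k) c α
  mulE-mulX (suc k) (suc c) (suc a ∷ α)       =
    ≃-trans (⊕-cong (mulE-mulX (suc k) c α) (mulE-mulX k c α)) (≃-sym (mulX-⊕ c α))

-- The series of proper words and its recurrence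

module GradedSeries (M : CommutativeMonoid 0ℓ 0ℓ)
  (t : SeriesOver.A M → SeriesOver.A M) (t-additive : SeriesOver.Additive M t) (one : SeriesOver.A M) where

  open SeriesOver M

  t-cong : ∀ {a b} → a ≃ b → t a ≃ t b
  t-cong = f-cong t-additive

  pow : ℕ → A → A
  pow zero    a = a
  pow (suc m) a = t (pow m a)

  -- [m]_t a
  qint : ℕ → A → A
  qint zero    a = 𝟎
  qint (suc m) a = pow m a ⊕ qint m a

  pow-additive : ∀ m → Additive (pow m)
  pow-additive zero    = id-additive
  pow-additive (suc m) = ∘-additive t-additive (pow-additive m)

  qint-additive : ∀ m → Additive (qint m)
  qint-additive zero    = 𝟎-additive
  qint-additive (suc m) = ⊕-additive (pow-additive m) (qint-additive m)

  tq : ℕ → A → A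
  tq m = t ∘ qint m

  tq-additive : ∀ m → Additive (tq m)
  tq-additive m = ∘-additive t-additive (qint-additive m)

  t-pow : ∀ m a → t (pow m a) ≃ pow m (t a)
  t-pow zero    a = ≃-refl
  t-pow (suc m) a = t-cong (t-pow m a)

  t-qint : ∀ m a → t (qint m a) ≃ qint m (t a)
  t-qint zero    a = f-𝟎 t-additive
  t-qint (suc m) a = ≃-trans (f-⊕ t-additive _ _) (⊕-cong (t-pow m a) (t-qint m a))

  pow-tq : ∀ i j a → pow i (tq j a) ≃ tq j (pow i a)
  pow-tq zero    j a = ≃-refl
  pow-tq (suc i) j a = t-cong (≃-trans (pow-tq i j a) (t-qint j (pow i a)))

  -- In front of a word starting with the letter d, a letter c creates an
  -- ascent if c < d and is forbidden if c = d.
  step : ℕ → ℕ → A → A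
  step zero    zero    a = 𝟎
  step zero    (suc d) a = t a
  step (suc c) zero    a = a
  step (suc c) (suc d) a = step c d a

  step-additive : ∀ c d → Additive (step c d)
  step-additive zero    zero    = 𝟎-additive
  step-additive zero    (suc d) = t-additive
  step-additive (suc c) zero    = id-additive
  step-additive (suc c) (suc d) = step-additive c d

  ∑step : ℕ → (ℕ → Ser) → Ser
  ∑step c F α = ∑ (upTo (length α)) (λ d → step c d (F d α))

  -- Σ t^asc x^w over the proper words w of length n + 1 with first letter c + 1
  word : ℕ → ℕ → Ser
  word zero    c = mulX c (const one)
  word (suc n) c = mulX c (∑step c (word n))

  -- Write [k] for [k]_t.  The series below are P = Σ t^k e_k = ∏ (1 + t x_d),
  -- T = Σ [k] e_k, D = Σ t [k-1] e_k,
  -- R_c = ∏_{d<c} (1 + x_d) ∏_{d>c} (1 + t x_d) and N_c = x_c R_c.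
  P : Ser
  P []                = one
  P (zero ∷ α)        = P α
  P (suc zero ∷ α)    = t (P α)
  P (suc (suc _) ∷ α) = 𝟎

  T : Ser
  T []                = 𝟎
  T (zero ∷ α)        = T α
  T (suc zero ∷ α)    = P α ⊕ T α
  T (suc (suc _) ∷ α) = 𝟎

  D : Ser
  D []                = 𝟎
  D (zero ∷ α)        = D α
  D (suc zero ∷ α)    = t (T α)
  D (suc (suc _) ∷ α) = 𝟎

  R : ℕ → Ser
  R c       []                = 𝟎
  R zero    (zero ∷ α)        = P α
  R zero    (suc _ ∷ α)       = 𝟎
  R (suc c) (zero ∷ α)        = R c α
  R (suc c) (suc zero ∷ α)    = R c α
  R (suc c) (suc (suc _) ∷ α) = 𝟎

  N : ℕ → Ser
  N c = mulX c (R c)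

  -- A squarefree monomial of degree k occurs in N_d for each of its k variables x_d, weighted by t
  -- to the number of its variables after x_d. These weights are 1, t, ..., t^{k-1}, with sum [k]_t.
  ∑N : ∀ α → ∑ (upTo (length α)) (λ d → N d α) ≃ T α
  ∑N []                = ≃-refl
  ∑N (zero ∷ α)        = ≃-trans (∑-upTo-suc (length α)) (≃-trans (⊕-identityˡ _) (∑N α))
  ∑N (suc zero ∷ α)    = ≃-trans (∑-upTo-suc (length α)) (⊕-congˡ (∑N α))
  ∑N (suc (suc a) ∷ α) = ≃-trans (∑-upTo-suc (length α)) (≃-trans (⊕-identityˡ _)
    (≃-trans (∑-cong (upTo (length α)) (λ d → mulX-𝟎 d α)) (∑-𝟎 (upTo (length α)))))

  ∑step-zero : ∀ a α {F} → ∑step 0 F (a ∷ α) ≃ t (∑ (upTo (length α)) (λ d → F (suc d) (a ∷ α)))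
  ∑step-zero a α {F} = begin
    ∑step 0 F (a ∷ α)                                         ≈⟨ ∑-upTo-suc (length α) ⟩
    𝟎 ⊕ ∑ (upTo (length α)) (λ d → t (F (suc d) (a ∷ α)))     ≈⟨ ⊕-identityˡ _ ⟩
    ∑ (upTo (length α)) (λ d → t (F (suc d) (a ∷ α)))         ≈⟨ ∑-additive (upTo (length α)) t-additive ⟨
    t (∑ (upTo (length α)) (λ d → F (suc d) (a ∷ α)))         ∎

  -- For d > 0 the series N_d contains the factor 1 + x₁, so that its coefficients at the exponents
  -- 0 and 1 of x₁ coincide, and either one is N_{d-1} in the remaining variables.
  ∑stepN-zero : ∀ a α → a < 2 → ∑step 0 N (a ∷ α) ≃ t (T α)
  ∑stepN-zero zero          α _ = ≃-trans (∑step-zero 0 α {N}) (t-cong (∑N α))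
  ∑stepN-zero (suc zero)    α _ = ≃-trans (∑step-zero 1 α {N}) (t-cong (∑N α))
  ∑stepN-zero (suc (suc a)) α (s≤s (s≤s ()))

  ∑stepN-square : ∀ c a α → ∑step c N (suc (suc a) ∷ α) ≃ 𝟎
  ∑stepN-square c a α = ≃-trans (∑-cong (upTo (suc (length α))) vanish) (∑-𝟎 (upTo (suc (length α))))
    where
    vanish : ∀ d → step c d (N d (suc (suc a) ∷ α)) ≃ 𝟎
    vanish zero    = f-𝟎 (step-additive c zero)
    vanish (suc d) = ≃-trans (f-cong (step-additive c (suc d)) (mulX-𝟎 d α)) (f-𝟎 (step-additive c (suc d)))

  -- In degree k ≥ 1 this is t^k + t [k-1] = t [k]; in degree 0 both sides are 1.
  P⊕D≃1⊕tT : ∀ α → P α ⊕ D α ≃ const one α ⊕ t (T α)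
  P⊕D≃1⊕tT []                = ⊕-congˡ (≃-sym (f-𝟎 t-additive))
  P⊕D≃1⊕tT (zero ∷ α)        = P⊕D≃1⊕tT α
  P⊕D≃1⊕tT (suc zero ∷ α)    = ≃-sym (≃-trans (⊕-identityˡ _) (f-⊕ t-additive _ _))
  P⊕D≃1⊕tT (suc (suc a) ∷ α) = ⊕-congˡ (≃-sym (f-𝟎 t-additive))

  -- The coefficient of x₁ in `R⊕D≃1⊕∑stepN` when c is not the first letter. Stated on its own, it
  -- reproduces itself when x₁ is isolated, so that the induction closes.
  R⊕tT≃P⊕∑stepN : ∀ c α → c < length α → R c α ⊕ t (T α) ≃ P α ⊕ ∑step c N α
  R⊕tT≃P⊕∑stepN zero    (zero ∷ α)     _ = ⊕-congˡ (≃-sym (∑stepN-zero 0 α (s≤s z≤n)))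
  R⊕tT≃P⊕∑stepN zero    (suc zero ∷ α) _ = begin
    𝟎 ⊕ t (P α ⊕ T α)                ≈⟨ ⊕-identityˡ _ ⟩
    t (P α ⊕ T α)                    ≈⟨ f-⊕ t-additive _ _ ⟩
    t (P α) ⊕ t (T α)                ≈⟨ ⊕-congˡ (∑stepN-zero 1 α (s≤s (s≤s z≤n))) ⟨
    t (P α) ⊕ ∑step 0 N (1 ∷ α)      ∎
  R⊕tT≃P⊕∑stepN (suc c) (zero ∷ α)     (s≤s c<l) = begin
    R c α ⊕ t (T α)                  ≈⟨ R⊕tT≃P⊕∑stepN c α c<l ⟩
    P α ⊕ ∑step c N α                ≈⟨ ⊕-congˡ (⊕-identityˡ _) ⟨
    P α ⊕ (𝟎 ⊕ ∑step c N α)          ≈⟨ ⊕-congˡ (∑-upTo-suc (length α)) ⟨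
    P α ⊕ ∑step (suc c) N (zero ∷ α) ∎
  R⊕tT≃P⊕∑stepN (suc c) (suc zero ∷ α) (s≤s c<l) = begin
    R c α ⊕ t (P α ⊕ T α)            ≈⟨ ⊕-congˡ (f-⊕ t-additive _ _) ⟩
    R c α ⊕ (t (P α) ⊕ t (T α))      ≈⟨ x∙yz≈y∙xz _ _ _ ⟩
    t (P α) ⊕ (R c α ⊕ t (T α))      ≈⟨ ⊕-congˡ (R⊕tT≃P⊕∑stepN c α c<l) ⟩
    t (P α) ⊕ (P α ⊕ ∑step c N α)    ≈⟨ ⊕-congˡ (∑-upTo-suc (length α)) ⟨
    t (P α) ⊕ ∑step (suc c) N (1 ∷ α) ∎
  R⊕tT≃P⊕∑stepN zero    (suc (suc a) ∷ α) _ =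
    ⊕-congˡ (≃-trans (f-𝟎 t-additive) (≃-sym (∑stepN-square 0 a α)))
  R⊕tT≃P⊕∑stepN (suc c) (suc (suc a) ∷ α) _ =
    ⊕-congˡ (≃-trans (f-𝟎 t-additive) (≃-sym (∑stepN-square (suc c) a α)))

  -- Put F_c = ∏_{d<c} (1 + x_d) ∏_{d≥c} (1 + t x_d). Then (1 - t) N_d = F_{d+1} - F_d and (1 - t)
  -- R_c = F_c - t F_{c+1}, so that (1 - t) times the sum over d telescopes to (1 - t) R_c + t ∏ (1
  -- + x_d) - P. Here (t - t^k) / (1 - t) is t [k-1] for k ≥ 1 and -1 for k = 0, which gives R_c + D
  -- - 1; the -1 is moved to the other side.
  R⊕D≃1⊕∑stepN : ∀ c α → c < length α → R c α ⊕ D α ≃ const one α ⊕ ∑step c N α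
  R⊕D≃1⊕∑stepN zero    (zero ∷ α)     _ =
    ≃-trans (P⊕D≃1⊕tT α) (⊕-congˡ (≃-sym (∑stepN-zero 0 α (s≤s z≤n))))
  R⊕D≃1⊕∑stepN zero    (suc zero ∷ α) _ = ⊕-congˡ (≃-sym (∑stepN-zero 1 α (s≤s (s≤s z≤n))))
  R⊕D≃1⊕∑stepN (suc c) (zero ∷ α)     (s≤s c<l) = begin
    R c α ⊕ D α                             ≈⟨ R⊕D≃1⊕∑stepN c α c<l ⟩
    const one α ⊕ ∑step c N α               ≈⟨ ⊕-congˡ (⊕-identityˡ _) ⟨
    const one α ⊕ (𝟎 ⊕ ∑step c N α)         ≈⟨ ⊕-congˡ (∑-upTo-suc (length α)) ⟨
    const one α ⊕ ∑step (suc c) N (zero ∷ α) ∎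
  R⊕D≃1⊕∑stepN (suc c) (suc zero ∷ α) (s≤s c<l) = begin
    R c α ⊕ t (T α)              ≈⟨ R⊕tT≃P⊕∑stepN c α c<l ⟩
    P α ⊕ ∑step c N α            ≈⟨ ∑-upTo-suc (length α) ⟨
    ∑step (suc c) N (1 ∷ α)      ≈⟨ ⊕-identityˡ _ ⟨
    𝟎 ⊕ ∑step (suc c) N (1 ∷ α)  ∎
  R⊕D≃1⊕∑stepN zero    (suc (suc a) ∷ α) _ = ⊕-congˡ (≃-sym (∑stepN-square 0 a α))
  R⊕D≃1⊕∑stepN (suc c) (suc (suc a) ∷ α) _ = ⊕-congˡ (≃-sym (∑stepN-square (suc c) a α))

  -- The series a ∏ (1 + x_d), which agrees with a e_k in degree k. It permits an induction on the
  -- variables in which k need not be tracked.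
  squarefree : A → Ser
  squarefree a []                = a
  squarefree a (zero ∷ α)        = squarefree a α
  squarefree a (suc zero ∷ α)    = squarefree a α
  squarefree a (suc (suc _) ∷ α) = 𝟎

  squarefree-additive : ∀ {f} → Additive f → ∀ {a} α → squarefree (f a) α ≃ f (squarefree a α)
  squarefree-additive F []                = ≃-refl
  squarefree-additive F (zero ∷ α)        = squarefree-additive F α
  squarefree-additive F (suc zero ∷ α)    = squarefree-additive F α
  squarefree-additive F (suc (suc _) ∷ α) = ≃-sym (f-𝟎 F)

  squarefree-⊕ : ∀ {a b} α → squarefree (a ⊕ b) α ≃ squarefree a α ⊕ squarefree b α
  squarefree-⊕ []                = ≃-refl
  squarefree-⊕ (zero ∷ α)        = squarefree-⊕ α
  squarefree-⊕ (suc zero ∷ α)    = squarefree-⊕ α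
  squarefree-⊕ (suc (suc _) ∷ α) = ≃-sym (⊕-identityˡ 𝟎)

  mulE-const : ∀ a α → mulE (sum α) (const a) α ≃ squarefree a α
  mulE-const a []                = ≃-refl
  mulE-const a (zero ∷ α)        = ≃-trans (mulE-zero (sum α) α) (mulE-const a α)
    where
    mulE-zero : ∀ k α {G} → mulE k G (0 ∷ α) ≃ mulE k (λ β → G (0 ∷ β)) α
    mulE-zero zero    α = ≃-refl
    mulE-zero (suc k) α = ≃-refl
  mulE-const a (suc zero ∷ α)    = begin
    mulE (suc (sum α)) (λ _ → 𝟎) α ⊕ mulE (sum α) (const a) α
      ≈⟨ ⊕-cong (mulE-𝟎 (suc (sum α)) α) (mulE-const a α) ⟩
    𝟎 ⊕ squarefree a α
      ≈⟨ ⊕-identityˡ _ ⟩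
    squarefree a α ∎
  mulE-const a (suc (suc b) ∷ α) =
    ≃-trans (⊕-cong (mulE-𝟎 (suc (suc (b + sum α))) α) (mulE-𝟎 (suc (b + sum α)) α)) (⊕-identityˡ 𝟎)

  P-squarefree : ∀ α → P α ≃ squarefree (pow (sum α) one) α
  P-squarefree []                = ≃-refl
  P-squarefree (zero ∷ α)        = P-squarefree α
  P-squarefree (suc zero ∷ α)    =
    ≃-trans (t-cong (P-squarefree α)) (≃-sym (squarefree-additive t-additive α))
  P-squarefree (suc (suc _) ∷ α) = ≃-refl

  T-squarefree : ∀ α → T α ≃ squarefree (qint (sum α) one) α
  T-squarefree []                = ≃-refl
  T-squarefree (zero ∷ α)        = T-squarefree α
  T-squarefree (suc zero ∷ α)    =
    ≃-trans (⊕-cong (P-squarefree α) (T-squarefree α)) (≃-sym (squarefree-⊕ α))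
  T-squarefree (suc (suc _) ∷ α) = ≃-refl

  -- The value of `pred` at degree 0 is harmless: it yields t [0], which vanishes as the constant
  -- term of D does.
  D-squarefree : ∀ α → D α ≃ squarefree (tq (pred (sum α)) one) α
  D-squarefree []                = ≃-sym (f-𝟎 t-additive)
  D-squarefree (zero ∷ α)        = D-squarefree α
  D-squarefree (suc zero ∷ α)    =
    ≃-trans (t-cong (T-squarefree α)) (≃-sym (squarefree-additive t-additive α))
  D-squarefree (suc (suc _) ∷ α) = ≃-refl

  T≃mulE : ∀ n α → sum α ≡ n → T α ≃ mulE n (const (qint n one)) α
  T≃mulE n α refl = ≃-trans (T-squarefree α) (≃-sym (mulE-const _ α))

  D≃mulE : ∀ n α → sum α ≡ suc n → D α ≃ mulE (suc n) (const (tq n one)) α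
  D≃mulE n α eq = ≃-trans (D-squarefree α) (≃-trans (≃-sym (mulE-const _ α))
    (≃-reflexive (≡.cong (λ k → mulE k (const (tq (pred k) one)) α) eq)))

  -- The summand with j = 0 vanishes because [0]_t = 0. On the side of orientations this says that
  -- two adjacent vertices are never both sinks.
  convolve : ℕ → (ℕ → Ser) → Ser
  convolve n F α = ∑⋄ n (λ j m → mulE (suc j) (tq j ∘ F m) α)

  -- The constant term of R_c is 1 as soon as c is among the variables, and the factor x_c
  -- guarantees this.
  N-degree-one : ∀ c α → sum α ≡ 1 → word 0 c α ≃ N c α
  N-degree-one c α s = mulX-cong-deg c α λ β c<l _ s′ →
    const≃R c β c<l (ℕ.suc-injective (≡.trans s′ s))
    where
    const≃P : ∀ β → sum β ≡ 0 → const one β ≃ P β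
    const≃P []         _  = ≃-refl
    const≃P (zero ∷ β) eq = const≃P β eq

    const≃R : ∀ c β → c < length β → sum β ≡ 0 → const one β ≃ R c β
    const≃R zero    (zero ∷ β) _         eq = const≃P β eq
    const≃R (suc c) (zero ∷ β) (s≤s c<l) eq = const≃R c β c<l eq

  -- The formula for n is substituted into the system. In degree n + 1 the transitions from N_d sum
  -- to R_c + t [n] e_{n+1}. Multiplied by x_c, the first term becomes N_c, and the second becomes
  -- the new summand with m = 0, as W_{0,c} = x_c. In the remaining sum the transitions turn W_{m,d}
  -- into W_{m+1,c}, which shifts m by one.
  word-recurrence : ∀ n c α → sum α ≡ suc n →
    word n c α ≃ N c α ⊕ convolve n (λ m → word m c) α
  word-recurrence zero    c α s = ≃-trans (N-degree-one c α s) (≃-sym (⊕-identityʳ _))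
  word-recurrence (suc n) c α s = begin
    mulX c (∑step c (word n)) α
      ≈⟨ mulX-cong-deg c α (λ β c<l _ s′ → ∑step-word β c<l (ℕ.suc-injective (≡.trans s′ s))) ⟩
    mulX c (λ β → R c β ⊕ (convolve n (λ m → ∑step c (word m)) β ⊕ E β)) α
      ≈⟨ mulX-⊕ c α ⟩
    N c α ⊕ mulX c (λ β → convolve n (λ m → ∑step c (word m)) β ⊕ E β) α
      ≈⟨ ⊕-congˡ (mulX-⊕ c α) ⟩
    N c α ⊕ (mulX c (convolve n (λ m → ∑step c (word m))) α ⊕ mulX c E α)
      ≈⟨ ⊕-congˡ (⊕-cong mulX-convolve
           (mulX-tq n (const one))) ⟩
    N c α ⊕ (∑⋄ n (λ j m → mulE (suc j) (tq j ∘ word (suc m) c) α)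
              ⊕ mulE (suc n) (tq n ∘ word 0 c) α)
      ≈⟨ ⊕-congˡ (∑⋄-last n _) ⟨
    N c α ⊕ convolve (suc n) (λ m → word m c) α ∎
    where
    E : Ser
    E = mulE (suc n) (tq n ∘ const one)

    mulX-tq : ∀ j F → mulX c (mulE (suc j) (tq j ∘ F)) α ≃ mulE (suc j) (tq j ∘ mulX c F) α
    mulX-tq j F = ≃-trans (≃-sym (mulE-mulX (suc j) c α))
      (mulE-cong (suc j) α (λ β → mulX-additive (tq-additive j) c β))

    mulX-convolve : mulX c (convolve n (λ m → ∑step c (word m))) α ≃
                    ∑⋄ n (λ j m → mulE (suc j) (tq j ∘ word (suc m) c) α)
    mulX-convolve = ≃-trans (∑-linear (mulX-linear c α) (antidiagonal n) _)
      (∑⋄-cong n (λ j m _ → mulX-tq j (∑step c (word m))))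

    ∑step-convolve : ∀ β → ∑step c (λ d → convolve n (λ m → word m d)) β ≃
                           convolve n (λ m → ∑step c (word m)) β
    ∑step-convolve β = begin
      ∑ (upTo (length β)) (λ d → step c d (convolve n (λ m → word m d) β))
        ≈⟨ ∑-cong (upTo (length β)) (λ d → ∑-additive (antidiagonal n) (step-additive c d)) ⟩
      ∑ (upTo (length β)) (λ d → ∑⋄ n (λ j m → step c d (mulE (suc j) (tq j ∘ word m d) β)))
        ≈⟨ ∑-comm (upTo (length β)) (antidiagonal n) _ ⟩
      ∑⋄ n (λ j m → ∑ (upTo (length β)) (λ d → step c d (mulE (suc j) (tq j ∘ word m d) β)))
        ≈⟨ ∑⋄-cong n (λ j m _ → inner j m) ⟩
      convolve n (λ m → ∑step c (word m)) β ∎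
      where
      inner : ∀ j m → ∑ (upTo (length β)) (λ d → step c d (mulE (suc j) (tq j ∘ word m d) β)) ≃
                      mulE (suc j) (tq j ∘ ∑step c (word m)) β
      inner j m = begin
        ∑ (upTo (length β)) (λ d → step c d (mulE (suc j) (tq j ∘ word m d) β))
          ≈⟨ ∑-cong (upTo (length β)) (λ d → ≃-trans
               (f-cong (step-additive c d) (mulE-additive (tq-additive j) (suc j) β))
               (commute d)) ⟩
        ∑ (upTo (length β)) (λ d → tq j (mulE (suc j) (step c d ∘ word m d) β))
          ≈⟨ ∑-additive (upTo (length β)) (tq-additive j) ⟨
        tq j (∑ (upTo (length β)) (λ d → mulE (suc j) (step c d ∘ word m d) β))
          ≈⟨ f-cong (tq-additive j) (∑-linear (mulE-linear (suc j) β) (upTo (length β)) _) ⟨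
        tq j (mulE (suc j) (λ γ → ∑ (upTo (length β)) (λ d → step c d (word m d γ))) β)
          ≈⟨ mulE-additive (tq-additive j) (suc j) β ⟨
        mulE (suc j) (λ γ → tq j (∑ (upTo (length β)) (λ d → step c d (word m d γ)))) β
          ≈⟨ mulE-cong-deg (suc j) β (λ γ eq _ → ≃-reflexive
               (cong (λ l → tq j (∑ (upTo l) (λ d → step c d (word m d γ)))) (≡.sym eq))) ⟩
        mulE (suc j) (tq j ∘ ∑step c (word m)) β ∎
        where
        step-tq : ∀ c d j a → step c d (tq j a) ≃ tq j (step c d a)
        step-tq zero    zero    j a = ≃-sym (f-𝟎 (tq-additive j))
        step-tq (suc c) zero    j a = ≃-refl
        step-tq (suc c) (suc d) j a = step-tq c d j a
        step-tq zero    (suc d) j a = t-cong (t-qint j a)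

        commute : ∀ d → step c d (tq j (mulE (suc j) (word m d) β)) ≃
                        tq j (mulE (suc j) (step c d ∘ word m d) β)
        commute d = ≃-trans (step-tq c d j _)
          (f-cong (tq-additive j) (≃-sym (mulE-additive (step-additive c d) (suc j) β)))

    ∑step-word : ∀ β → c < length β → sum β ≡ suc n →
      ∑step c (word n) β ≃ R c β ⊕ (convolve n (λ m → ∑step c (word m)) β ⊕ E β)
    ∑step-word β c<l s′ = begin
      ∑step c (word n) β
        ≈⟨ ∑-cong (upTo (length β)) (λ d → ≃-trans
             (f-cong (step-additive c d) (word-recurrence n d β s′)) (f-⊕ (step-additive c d) _ _)) ⟩
      ∑ (upTo (length β)) (λ d → step c d (N d β) ⊕ step c d (convolve n (λ m → word m d) β))
        ≈⟨ ∑-⊕ (upTo (length β)) ⟩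
      ∑step c N β ⊕ ∑step c (λ d → convolve n (λ m → word m d)) β
        ≈⟨ ⊕-cong ∑stepN (∑step-convolve β) ⟩
      R c β ⊕ E β ⊕ convolve n (λ m → ∑step c (word m)) β
        ≈⟨ ≃-trans (⊕-assoc _ _ _) (⊕-congˡ (⊕-comm _ _)) ⟩
      R c β ⊕ (convolve n (λ m → ∑step c (word m)) β ⊕ E β) ∎
      where
      const-positive : ∀ β {n} → sum β ≡ suc n → const one β ≃ 𝟎
      const-positive (zero ∷ β)  eq = const-positive β eq
      const-positive (suc _ ∷ β) eq = ≃-refl

      ∑stepN : ∑step c N β ≃ R c β ⊕ E β
      ∑stepN = begin
        ∑step c N β               ≈⟨ ⊕-identityˡ _ ⟨
        -- The constant 1 of the identity is invisible in positive degree, which removes its only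
        -- term without a counterpart.
        𝟎 ⊕ ∑step c N β           ≈⟨ ⊕-congʳ (const-positive β s′) ⟨
        const one β ⊕ ∑step c N β ≈⟨ R⊕D≃1⊕∑stepN c β c<l ⟨
        R c β ⊕ D β               ≈⟨ ⊕-congˡ (D≃mulE n β s′) ⟩
        R c β ⊕ mulE (suc n) (const (tq n one)) β
          ≈⟨ ⊕-congˡ (mulE-cong (suc n) β (const-additive (tq-additive n))) ⟩
        R c β ⊕ E β               ∎

  words : ℕ → Ser
  words n α = ∑ (upTo (length α)) (λ c → word n c α)

  words-recurrence : ∀ n α → sum α ≡ suc n →
    words n α ≃ mulE (suc n) (const (qint (suc n) one)) α ⊕ convolve n words α
  words-recurrence n α s = begin
    words n α
      ≈⟨ ∑-cong (upTo (length α)) (λ c → word-recurrence n c α s) ⟩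
    ∑ (upTo (length α)) (λ c → N c α ⊕ convolve n (λ m → word m c) α)
      ≈⟨ ∑-⊕ (upTo (length α)) ⟩
    ∑ (upTo (length α)) (λ c → N c α) ⊕ ∑ (upTo (length α)) (λ c → convolve n (λ m → word m c) α)
      ≈⟨ ⊕-cong (≃-trans (∑N α) (T≃mulE (suc n) α s)) (≃-trans (∑-comm (upTo (length α)) (antidiagonal n) _)
           (∑⋄-cong n (λ j m _ → inner j m))) ⟩
    mulE (suc n) (const (qint (suc n) one)) α ⊕ convolve n words α ∎
    where
    inner : ∀ j m → ∑ (upTo (length α)) (λ c → mulE (suc j) (tq j ∘ word m c) α) ≃
                    mulE (suc j) (tq j ∘ words m) α
    inner j m = ≃-trans (≃-sym (∑-linear (mulE-linear (suc j) α) (upTo (length α)) _))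
      (mulE-cong-deg (suc j) α λ β eq _ → ≃-trans (≃-sym (∑-additive (upTo (length α)) (tq-additive j)))
        (≃-reflexive (cong (λ l → tq j (∑ (upTo l) (λ c → word m c β))) (≡.sym eq))))

-- The series of orientations and its recurrence

-- An orientation of the path on n + 1 vertices is encoded by a vector of n
-- bits, true standing for an edge directed to the right.
bits : ∀ n → List (Vec Bool n)
bits = vectors (true ∷ false ∷ [])

trues : ∀ {n} → Vec Bool n → ℕ
trues []          = 0
trues (true ∷ b)  = suc (trues b)
trues (false ∷ b) = trues b

-- The gaps between sinks, up to order, read off from left to right.  Here r
-- is the number of vertices before the first sink and g the number of vertices
-- since the last one, the current vertex being excluded; in the states initial
-- and up the edge entering the current vertex from the left, if any, points to
-- it, so that it is a sink unless the next edge leaves it.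
initial : ∀ {n} → ℕ → Vec Bool n → List ℕ
down up : ∀ {n} → ℕ → ℕ → Vec Bool n → List ℕ

initial r []          = r ∷ []
initial r (true ∷ b)  = initial (suc r) b
initial r (false ∷ b) = down r 0 b

down r g []          = (r + suc g) ∷ []
down r g (true ∷ b)  = up r (suc g) b
down r g (false ∷ b) = down r (suc g) b

up r g []          = g ∷ r ∷ []
up r g (true ∷ b)  = up r (suc g) b
up r g (false ∷ b) = g ∷ down r 0 b

module OrientationSeries (M : CommutativeMonoid 0ℓ 0ℓ)
  (t : SeriesOver.A M → SeriesOver.A M) (t-additive : SeriesOver.Additive M t) (one : SeriesOver.A M) where

  open SeriesOver M

  open GradedSeries M t t-additive one

  -- A gap of k vertices and one adjoining sink form a part k + 1; hence the `map suc` and the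
  -- product of the e_{k+1}.
  ∑bits : ∀ n → (Vec Bool n → List ℕ) → Ser
  ∑bits n h α = ∑ (bits n) (λ b → mulEs (map suc (h b)) (const (pow (trues b) one)) α)

  ∑bits-zero : ∀ h α → ∑bits 0 h α ≃ mulEs (map suc (h [])) (const one) α
  ∑bits-zero h α = ⊕-identityʳ _

  ∑bits-suc : ∀ n h α → ∑bits (suc n) h α ≃ t (∑bits n (h ∘ (true ∷_)) α) ⊕ ∑bits n (h ∘ (false ∷_)) α
  ∑bits-suc n h α = begin
    ∑bits (suc n) h α
      ≈⟨ ∑-cartesianProductWith _∷_ (true ∷ false ∷ []) (bits n) ⟩
    ∑ (bits n) (λ b → mulEs (map suc (h (true ∷ b))) (const (t (pow (trues b) one))) α) ⊕
      (∑bits n (h ∘ (false ∷_)) α ⊕ 𝟎)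
      ≈⟨ ⊕-cong (∑-cong (bits n) pull-t) (⊕-identityʳ _) ⟩
    ∑ (bits n) (λ b → t (mulEs (map suc (h (true ∷ b))) (const (pow (trues b) one)) α)) ⊕
      ∑bits n (h ∘ (false ∷_)) α
      ≈⟨ ⊕-congʳ (∑-additive (bits n) t-additive) ⟨
    t (∑bits n (h ∘ (true ∷_)) α) ⊕ ∑bits n (h ∘ (false ∷_)) α ∎
    where
    pull-t : ∀ b → mulEs (map suc (h (true ∷ b))) (const (t (pow (trues b) one))) α ≃
                   t (mulEs (map suc (h (true ∷ b))) (const (pow (trues b) one)) α)
    pull-t b = ≃-trans (mulEs-cong (map suc (h (true ∷ b))) (const-additive t-additive) α)
                       (mulEs-additive t-additive (map suc (h (true ∷ b))) α)

  ∑bits-∷ : ∀ n k h α → ∑bits n (λ b → k ∷ h b) α ≃ mulE (suc k) (∑bits n h) α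
  ∑bits-∷ n k h α = ≃-sym (∑-linear (mulE-linear (suc k) α) (bits n) _)

  -- The part to the right of the first sink, when it has m vertices and there
  -- are r vertices before this sink.
  tailSeries : ℕ → ℕ → Ser
  tailSeries r zero    = mulE (suc r) (const one)
  tailSeries r (suc m) = ∑bits m (down r 0)

  -- In this state the next sink is reached after j edges to the right, each counted by t, and
  -- closes a gap of g + j vertices; m vertices follow it.
  ∑up : ∀ n r g α → ∑bits n (up r g) α ≃
        ∑⋄ (suc n) (λ j m → pow j (mulE (suc (g + j)) (tailSeries r m) α))
  ∑up zero    r g α = ≃-trans (∑bits-zero (up r g) α) (≃-trans
    (≃-reflexive (cong (λ k → mulE (suc k) (tailSeries r 0) α) (≡.sym (ℕ.+-identityʳ g))))
    (≃-sym (⊕-identityʳ _)))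
  ∑up (suc n) r g α = begin
    ∑bits (suc n) (up r g) α
      ≈⟨ ∑bits-suc n (up r g) α ⟩
    t (∑bits n (up r (suc g)) α) ⊕ ∑bits n (λ b → g ∷ down r 0 b) α
      ≈⟨ ⊕-cong (t-cong (∑up n r (suc g) α)) (∑bits-∷ n g (down r 0) α) ⟩
    t (∑⋄ (suc n) (λ j m → pow j (mulE (suc (suc g + j)) (tailSeries r m) α))) ⊕
      mulE (suc g) (tailSeries r (suc n)) α
      ≈⟨ ⊕-congʳ (∑-additive (antidiagonal (suc n)) t-additive) ⟩
    ∑⋄ (suc n) (λ j m → pow (suc j) (mulE (suc (suc g + j)) (tailSeries r m) α)) ⊕
      mulE (suc g) (tailSeries r (suc n)) α
      ≈⟨ ⊕-comm _ _ ⟩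
    mulE (suc g) (tailSeries r (suc n)) α ⊕
      ∑⋄ (suc n) (λ j m → pow (suc j) (mulE (suc (suc g + j)) (tailSeries r m) α))
      ≈⟨ ⊕-cong (≃-reflexive (cong (λ k → mulE (suc k) (tailSeries r (suc n)) α) (ℕ.+-identityʳ g)))
           (∑⋄-cong (suc n) (λ j m _ →
              ≃-reflexive (cong (λ k → pow (suc j) (mulE (suc k) (tailSeries r m) α)) (ℕ.+-suc g j)))) ⟨
    mulE (suc (g + 0)) (tailSeries r (suc n)) α ⊕
      ∑⋄ (suc n) (λ j m → pow (suc j) (mulE (suc (g + suc j)) (tailSeries r m) α))
      ≈⟨ ∑⋄-suc (suc n) _ ⟨
    ∑⋄ (suc (suc n)) (λ j m → pow j (mulE (suc (g + j)) (tailSeries r m) α)) ∎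

  -- If all n edges point to the left, no sink follows, and the g + n + 1 vertices after the last
  -- sink join the first r in the outer gap. Otherwise the next sink lies j edges further on; these
  -- edges first point to the left and then, at least once, to the right, so that their weights t,
  -- ..., t^j sum to t [j].
  ∑down : ∀ n r g α → ∑bits n (down r g) α ≃
          mulE (suc (r + suc (g + n))) (const one) α ⊕
          ∑⋄ (suc n) (λ j m → tq j (mulE (suc (g + j)) (tailSeries r m) α))
  ∑down zero    r g α = begin
    ∑bits 0 (down r g) α
      ≈⟨ ∑bits-zero (down r g) α ⟩
    mulE (suc (r + suc g)) (const one) α
      ≈⟨ ⊕-identityʳ _ ⟨
    mulE (suc (r + suc g)) (const one) α ⊕ 𝟎
      ≈⟨ ⊕-cong (≃-reflexive (cong (λ k → mulE (suc (r + suc k)) (const one) α) (≡.sym (ℕ.+-identityʳ g))))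
                (≃-sym (≃-trans (⊕-identityʳ _) (f-𝟎 t-additive))) ⟩
    mulE (suc (r + suc (g + 0))) (const one) α ⊕
      ∑⋄ 1 (λ j m → tq j (mulE (suc (g + j)) (tailSeries r m) α)) ∎
  ∑down (suc n) r g α = begin
    ∑bits (suc n) (down r g) α
      ≈⟨ ∑bits-suc n (down r g) α ⟩
    t (∑bits n (up r (suc g)) α) ⊕ ∑bits n (down r (suc g)) α
      ≈⟨ ⊕-cong (≃-trans (t-cong (∑up n r (suc g) α)) (∑-additive (antidiagonal (suc n)) t-additive))
                (∑down n r (suc g) α) ⟩
    ∑⋄ (suc n) (λ j m → t (pow j (mulE (suc (suc g + j)) (tailSeries r m) α))) ⊕
      (mulE (suc (r + suc (suc g + n))) (const one) α ⊕
       ∑⋄ (suc n) (λ j m → tq j (mulE (suc (suc g + j)) (tailSeries r m) α)))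
      ≈⟨ x∙yz≈y∙xz _ _ _ ⟩
    mulE (suc (r + suc (suc g + n))) (const one) α ⊕
      (∑⋄ (suc n) (λ j m → t (pow j (mulE (suc (suc g + j)) (tailSeries r m) α))) ⊕
       ∑⋄ (suc n) (λ j m → tq j (mulE (suc (suc g + j)) (tailSeries r m) α)))
      ≈⟨ ⊕-cong (≃-reflexive (cong (λ k → mulE (suc (r + suc k)) (const one) α) (≡.sym (ℕ.+-suc g n))))
                (≃-sym (∑-⊕ (antidiagonal (suc n)))) ⟩
    mulE (suc (r + suc (g + suc n))) (const one) α ⊕
      ∑⋄ (suc n) (λ j m → t (pow j (mulE (suc (suc g + j)) (tailSeries r m) α)) ⊕
                          tq j (mulE (suc (suc g + j)) (tailSeries r m) α))
      ≈⟨ ⊕-congˡ (∑⋄-cong (suc n) (λ j m _ → ≃-trans (≃-sym (f-⊕ t-additive _ _)) (≃-reflexive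
           (cong (λ k → tq (suc j) (mulE (suc k) (tailSeries r m) α)) (≡.sym (ℕ.+-suc g j)))))) ⟩
    mulE (suc (r + suc (g + suc n))) (const one) α ⊕
      ∑⋄ (suc n) (λ j m → tq (suc j) (mulE (suc (g + suc j)) (tailSeries r m) α))
      ≈⟨ ⊕-congˡ (≃-trans (⊕-congʳ (f-𝟎 t-additive)) (⊕-identityˡ _)) ⟨
    mulE (suc (r + suc (g + suc n))) (const one) α ⊕
      (tq 0 (mulE (suc (g + 0)) (tailSeries r (suc n)) α) ⊕
       ∑⋄ (suc n) (λ j m → tq (suc j) (mulE (suc (g + suc j)) (tailSeries r m) α)))
      ≈⟨ ⊕-congˡ (∑⋄-suc (suc n) _) ⟨
    mulE (suc (r + suc (g + suc n))) (const one) α ⊕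
      ∑⋄ (suc (suc n)) (λ j m → tq j (mulE (suc (g + j)) (tailSeries r m) α)) ∎

  -- The first of m ≥ 1 vertices after a sink has its edge to the sink fixed, so that m - 1 edges
  -- remain; this is `∑down` with g = 0. If m = 0, only the outer gap r is left.
  tailSeries-recurrence : ∀ r m α → tailSeries r m α ≃
    mulE (suc (r + m)) (const one) α ⊕ ∑⋄ m (λ j l → tq j (mulE (suc j) (tailSeries r l) α))
  tailSeries-recurrence r zero    α = ≃-trans
    (≃-reflexive (cong (λ k → mulE (suc k) (const one) α) (≡.sym (ℕ.+-identityʳ r))))
    (≃-sym (⊕-identityʳ _))
  tailSeries-recurrence r (suc m) α = ∑down m r 0 α

  -- The first sink is preceded exclusively by edges to the right; i counts those still to be read.
  ∑initial : ∀ n r α → ∑bits n (initial r) α ≃ ∑⋄ (suc n) (λ i m → pow i (tailSeries (i + r) m α))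
  ∑initial zero    r α = ≃-trans (∑bits-zero (initial r) α) (≃-sym (⊕-identityʳ _))
  ∑initial (suc n) r α = begin
    ∑bits (suc n) (initial r) α
      ≈⟨ ∑bits-suc n (initial r) α ⟩
    t (∑bits n (initial (suc r)) α) ⊕ tailSeries r (suc n) α
      ≈⟨ ⊕-congʳ (≃-trans (t-cong (∑initial n (suc r) α)) (∑-additive (antidiagonal (suc n)) t-additive)) ⟩
    ∑⋄ (suc n) (λ i m → pow (suc i) (tailSeries (i + suc r) m α)) ⊕ tailSeries r (suc n) α
      ≈⟨ ⊕-comm _ _ ⟩
    tailSeries r (suc n) α ⊕ ∑⋄ (suc n) (λ i m → pow (suc i) (tailSeries (i + suc r) m α))
      ≈⟨ ⊕-congˡ (∑⋄-cong (suc n) (λ i m _ →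
           ≃-reflexive (cong (λ k → pow (suc i) (tailSeries k m α)) (ℕ.+-suc i r)))) ⟩
    tailSeries r (suc n) α ⊕ ∑⋄ (suc n) (λ i m → pow (suc i) (tailSeries (suc i + r) m α))
      ≈⟨ ∑⋄-suc (suc n) _ ⟨
    ∑⋄ (suc (suc n)) (λ i m → pow i (tailSeries (i + r) m α)) ∎

  ∑⋄-pow : ∀ n a → ∑⋄ n (λ i _ → pow i a) ≃ qint n a
  ∑⋄-pow zero    a = ≃-refl
  ∑⋄-pow (suc n) a = ≃-trans (∑⋄-last n _) (≃-trans (⊕-comm _ _) (⊕-congˡ (∑⋄-pow n a)))

  orientationSeries : ℕ → Ser
  orientationSeries n = ∑bits n (initial 0)

  -- With a single sink preceded by i vertices the weight is t^i, and i = 0, ..., n gives [n+1]_t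
  -- e_{n+1}. With more sinks, cutting out the gap of j vertices after the first sink together with
  -- the second sink leaves an orientation with the same outer gap; `∑⋄-assoc` brings j to the
  -- outside, and the sum over i then reassembles the shorter orientations.
  orientationSeries-recurrence : ∀ n α → orientationSeries n α ≃
    mulE (suc n) (const (qint (suc n) one)) α ⊕ convolve n orientationSeries α
  orientationSeries-recurrence n α = begin
    orientationSeries n α
      ≈⟨ ∑initial n 0 α ⟩
    ∑⋄ (suc n) (λ i m → pow i (tailSeries (i + 0) m α))
      ≈⟨ ∑⋄-cong (suc n) expand ⟩
    ∑⋄ (suc n) (λ i m → pow i (mulE (suc n) (const one) α) ⊕ ∑⋄ m (F i))
      ≈⟨ ∑-⊕ (antidiagonal (suc n)) ⟩
    ∑⋄ (suc n) (λ i m → pow i (mulE (suc n) (const one) α)) ⊕ ∑⋄ (suc n) (λ i m → ∑⋄ m (F i))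
      ≈⟨ ⊕-cong (∑⋄-pow (suc n) _) (∑⋄-assoc (suc n) F) ⟩
    qint (suc n) (mulE (suc n) (const one) α) ⊕ ∑⋄ (suc n) (λ j m → ∑⋄ m (λ i l → F i j l))
      -- The pair with m = 0 has an empty inner sum, so only the pairs with a positive second entry,
      -- written `suc m`, remain.
      ≈⟨ ⊕-cong (mulE-additive (qint-additive (suc n)) (suc n) α)
                (≃-trans (≃-sym (⊕-identityʳ _)) (≃-sym (∑⋄-last n _))) ⟨
    mulE (suc n) (qint (suc n) ∘ const one) α ⊕ ∑⋄ n (λ j m → ∑⋄ (suc m) (λ i l → F i j l))
      ≈⟨ ⊕-cong (mulE-cong (suc n) α (const-additive (qint-additive (suc n))))
                (∑⋄-cong n (λ j m _ → collect j m)) ⟨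
    mulE (suc n) (const (qint (suc n) one)) α ⊕ convolve n orientationSeries α ∎
    where
    F : ℕ → ℕ → ℕ → A
    F i j l = pow i (tq j (mulE (suc j) (tailSeries (i + 0) l) α))

    expand : ∀ i m → suc (i + m) ≡ suc n →
             pow i (tailSeries (i + 0) m α) ≃ pow i (mulE (suc n) (const one) α) ⊕ ∑⋄ m (F i)
    expand i m eq = begin
      pow i (tailSeries (i + 0) m α)
        ≈⟨ f-cong (pow-additive i) (tailSeries-recurrence (i + 0) m α) ⟩
      pow i (mulE (suc (i + 0 + m)) (const one) α ⊕
             ∑⋄ m (λ j l → tq j (mulE (suc j) (tailSeries (i + 0) l) α)))
        ≈⟨ f-⊕ (pow-additive i) _ _ ⟩
      pow i (mulE (suc (i + 0 + m)) (const one) α) ⊕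
        pow i (∑⋄ m (λ j l → tq j (mulE (suc j) (tailSeries (i + 0) l) α)))
        ≈⟨ ⊕-cong (≃-reflexive (cong (λ k → pow i (mulE k (const one) α))
                     (≡.trans (cong (λ k → suc (k + m)) (ℕ.+-identityʳ i)) eq)))
                  (∑-additive (antidiagonal m) (pow-additive i)) ⟩
      pow i (mulE (suc n) (const one) α) ⊕ ∑⋄ m (F i) ∎

    collect : ∀ j m → mulE (suc j) (tq j ∘ orientationSeries m) α ≃ ∑⋄ (suc m) (λ i l → F i j l)
    collect j m = begin
      mulE (suc j) (tq j ∘ orientationSeries m) α
        ≈⟨ mulE-additive (tq-additive j) (suc j) α ⟩
      tq j (mulE (suc j) (orientationSeries m) α)
        ≈⟨ f-cong (tq-additive j) (mulE-cong (suc j) α (∑initial m 0)) ⟩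
      tq j (mulE (suc j) (λ β → ∑⋄ (suc m) (λ i l → pow i (tailSeries (i + 0) l β))) α)
        ≈⟨ f-cong (tq-additive j) (∑-linear (mulE-linear (suc j) α) (antidiagonal (suc m)) _) ⟩
      tq j (∑⋄ (suc m) (λ i l → mulE (suc j) (pow i ∘ tailSeries (i + 0) l) α))
        ≈⟨ ∑-additive (antidiagonal (suc m)) (tq-additive j) ⟩
      ∑⋄ (suc m) (λ i l → tq j (mulE (suc j) (pow i ∘ tailSeries (i + 0) l) α))
        ≈⟨ ∑⋄-cong (suc m) (λ i l _ → ≃-trans
             (f-cong (tq-additive j) (mulE-additive (pow-additive i) (suc j) α))
             (≃-sym (pow-tq i j _))) ⟩
      ∑⋄ (suc m) (λ i l → F i j l) ∎

  words≃orientationSeries : ∀ n α → sum α ≡ suc n → words n α ≃ orientationSeries n α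
  words≃orientationSeries = <-rec _ λ n rec α s → begin
    words n α
      ≈⟨ words-recurrence n α s ⟩
    mulE (suc n) (const (qint (suc n) one)) α ⊕ convolve n words α
      ≈⟨ ⊕-congˡ (∑⋄-cong n λ j m eq → mulE-cong-deg (suc j) α λ β _ s′ →
           f-cong (tq-additive j) (rec (≡.subst (m <_) eq (s≤s (ℕ.m≤n+m m j))) β
             (degree j m n (sum β) eq (≡.trans s′ s)))) ⟩
    mulE (suc n) (const (qint (suc n) one)) α ⊕ convolve n orientationSeries α
      ≈⟨ orientationSeries-recurrence n α ⟨
    orientationSeries n α ∎
    where
    degree : ∀ j m n s → suc (j + m) ≡ n → suc (j + s) ≡ suc n → s ≡ suc m
    degree j m n s eq eq′ = ℕ.+-cancelˡ-≡ j s (suc m)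
      (≡.trans (ℕ.suc-injective eq′) (≡.trans (≡.sym eq) (≡.sym (ℕ.+-suc j m))))

-- Conjugate partitions

#pos : List ℕ → ℕ
#pos []           = 0
#pos (zero ∷ μ)   = #pos μ
#pos (suc k ∷ μ)  = suc (#pos μ)

-- The first N parts of the conjugate partition, obtained by removing the
-- columns of the Young diagram one by one.
conj : ℕ → List ℕ → List ℕ
conj zero    μ = []
conj (suc N) μ = #pos μ ∷ conj N (map pred μ)

All-pred-≤ : ∀ {N μ} → All (_≤ suc N) μ → All (_≤ N) (map pred μ)
All-pred-≤ = All.map⁺ ∘ All.map ℕ.pred-mono-≤

sum-conj : ∀ N μ → All (_≤ N) μ → sum (conj N μ) ≡ sum μ
sum-conj zero    []         []         = refl
sum-conj zero    (zero ∷ μ) (_ ∷ μ≤0)  = sum-conj zero μ μ≤0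
sum-conj (suc N) μ          μ≤         =
  ≡.trans (cong (#pos μ +_) (sum-conj N (map pred μ) (All-pred-≤ μ≤))) (#pos+sum-pred μ)
  where
  #pos+sum-pred : ∀ μ → #pos μ + sum (map pred μ) ≡ sum μ
  #pos+sum-pred []          = refl
  #pos+sum-pred (zero ∷ μ)  = #pos+sum-pred μ
  #pos+sum-pred (suc k ∷ μ) = cong suc (≡.trans
    (ℕ-+.x∙yz≈y∙xz (#pos μ) k (sum (map pred μ))) (cong (k +_) (#pos+sum-pred μ)))

#pos-zero : ∀ {μ} → Linked _≥_ (0 ∷ μ) → #pos μ ≡ 0
#pos-zero [-]       = refl
#pos-zero (z≤n ∷ l) = #pos-zero l

#pos-pred-injective : ∀ {μ ν} → Linked _≥_ μ → Linked _≥_ ν →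
                      #pos μ ≡ #pos ν → map pred μ ≡ map pred ν → μ ≡ ν
#pos-pred-injective {[]}              {[]}              _ _ _  _  = refl
#pos-pred-injective {zero ∷ _}        {zero ∷ _}        l m eq ps =
  cong (0 ∷_) (#pos-pred-injective (Linked.tail l) (Linked.tail m) eq (List.∷-injectiveʳ ps))
#pos-pred-injective {suc _ ∷ _}       {suc _ ∷ _}       l m eq ps =
  cong₂ _∷_ (cong suc (List.∷-injectiveˡ ps))
    (#pos-pred-injective (Linked.tail l) (Linked.tail m) (ℕ.suc-injective eq) (List.∷-injectiveʳ ps))
#pos-pred-injective {zero ∷ _}        {suc _ ∷ _}       l m eq ps =
  contradiction (≡.trans (≡.sym eq) (#pos-zero l)) λ ()
#pos-pred-injective {suc _ ∷ _}       {zero ∷ _}        l m eq ps =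
  contradiction (≡.trans eq (#pos-zero m)) λ ()

-- The conjugate sees only the multiset of nonzero parts. Removing a column may turn parts into
-- zeros, which stay in the list, so the order and the length have to be known to recover it.
conj-injective : ∀ N {μ ν} → All (_≤ N) μ → All (_≤ N) ν → Linked _≥_ μ → Linked _≥_ ν →
                 length μ ≡ length ν → conj N μ ≡ conj N ν → μ ≡ ν
conj-injective zero    {[]}       {[]}       _       _       _ _ _  _  = refl
conj-injective zero    {zero ∷ _} {zero ∷ _} (_ ∷ p) (_ ∷ q) l m eq _  =
  cong (0 ∷_) (conj-injective zero p q (Linked.tail l) (Linked.tail m) (ℕ.suc-injective eq) refl)
conj-injective zero    {zero ∷ _} {suc _ ∷ _} _      (() ∷ _)
conj-injective (suc N) {μ}        {ν}        p       q       l m eq cs =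
  #pos-pred-injective l m (List.∷-injectiveˡ cs)
    (conj-injective N (All-pred-≤ p) (All-pred-≤ q) (Linked-pred l) (Linked-pred m)
      (≡.trans (List.length-map pred μ) (≡.trans eq (≡.sym (List.length-map pred ν)))) (List.∷-injectiveʳ cs))
  where
  Linked-pred : ∀ {μ} → Linked _≥_ μ → Linked _≥_ (map pred μ)
  Linked-pred = Linked.map⁺ ∘ Linked.map ℕ.pred-mono-≤

parts≤sum : ∀ μ → All (_≤ sum μ) μ
parts≤sum []      = []
parts≤sum (k ∷ μ) =
  ℕ.m≤m+n k (sum μ) ∷ All.map (λ p → ℕ.≤-trans p (ℕ.m≤n+m (sum μ) k)) (parts≤sum μ)

partition-parts≤ : ∀ {n μ} → IsPartition n μ → All (_≤ n) μ
partition-parts≤ {μ = μ} (_ , _ , refl) = parts≤sum μ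

partition-conj-injective : ∀ {n μ ν} → IsPartition (suc n) μ → IsPartition (suc n) ν →
                           conj (suc n) μ ≡ conj (suc n) ν → μ ≡ ν
partition-conj-injective {n} p@(l , μ>0 , _) q@(m , ν>0 , _) eq =
  conj-injective (suc n) (partition-parts≤ p) (partition-parts≤ q) l m
    -- As all parts are positive, the first entry of the conjugate is the number of parts.
    (≡.trans (≡.sym (#pos-length μ>0)) (≡.trans (List.∷-injectiveˡ eq) (#pos-length ν>0))) eq
  where
  #pos-length : ∀ {μ} → All (1 ≤_) μ → #pos μ ≡ length μ
  #pos-length []              = refl
  #pos-length (s≤s _ ∷ μ>0)   = cong suc (#pos-length μ>0)

-- Linear independence of the e_λ

module LinearIndependence (M : CommutativeMonoid 0ℓ 0ℓ)
  (⊕-cancelˡ : Algebra.LeftCancellative (CommutativeMonoid._≈_ M) (CommutativeMonoid._∙_ M)) where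

  open SeriesOver M

  -- x₁^{ℓ(μ)} is the highest power of x₁ in e_μ, with coefficient ∏ e_{μᵢ-1}.
  mulEs-exceeding : ∀ μ {p a} → #pos μ < a → ∀ β → mulEs μ (const p) (a ∷ β) ≃ 𝟎
  mulEs-exceeding []          {a = suc a} _         β = ≃-refl
  mulEs-exceeding (zero ∷ μ)  {a = suc a} μ<a       β = mulEs-exceeding μ μ<a β
  mulEs-exceeding (suc k ∷ μ) {a = suc a} (s≤s μ<a) β = ≃-trans (⊕-cong
    (≃-trans (mulE-cong (suc k) β (mulEs-exceeding μ (ℕ.m<n⇒m<1+n μ<a))) (mulE-𝟎 (suc k) β))
    (≃-trans (mulE-cong k β (mulEs-exceeding μ μ<a)) (mulE-𝟎 k β))) (⊕-identityˡ 𝟎)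

  mulEs-leading : ∀ μ {p} β → mulEs μ (const p) (#pos μ ∷ β) ≃ mulEs (map pred μ) (const p) β
  mulEs-leading []          β = ≃-refl
  mulEs-leading (zero ∷ μ)  β = mulEs-leading μ β
  mulEs-leading (suc k ∷ μ) β = ≃-trans (⊕-cong
    (≃-trans (mulE-cong (suc k) β (mulEs-exceeding μ (ℕ.n<1+n (#pos μ)))) (mulE-𝟎 (suc k) β))
    (mulE-cong k β (mulEs-leading μ))) (⊕-identityˡ _)

  coefficient-conj : ∀ N μ {p} → All (_≤ N) μ → mulEs μ (const p) (conj N μ) ≃ p
  coefficient-conj zero    []         []        = ≃-refl
  coefficient-conj zero    (zero ∷ μ) (_ ∷ μ≤0) = coefficient-conj zero μ μ≤0
  coefficient-conj (suc N) μ          μ≤        =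
    ≃-trans (mulEs-leading μ (conj N (map pred μ))) (coefficient-conj N (map pred μ) (All-pred-≤ μ≤))

  -- Up to the first difference the leading powers are split off from e_μ; there the exponent
  -- exceeds the number of positive parts left, and hence every power of that variable that can
  -- occur.
  coefficient-lex : ∀ N μ ν {p} → Lex-≤ _≡_ _<_ (conj N μ) (conj N ν) → conj N μ ≢ conj N ν →
                    mulEs μ (const p) (conj N ν) ≃ 𝟎
  coefficient-lex zero    μ ν _            ≢ = contradiction refl ≢
  coefficient-lex (suc N) μ ν (this μ<ν)   ≢ = mulEs-exceeding μ μ<ν (conj N (map pred ν))
  coefficient-lex (suc N) μ ν {p} (next μ≡ν le) ≢ = begin
    mulEs μ (const p) (#pos ν ∷ conj N (map pred ν))
      ≡⟨ cong (λ a → mulEs μ (const p) (a ∷ conj N (map pred ν))) μ≡ν ⟨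
    mulEs μ (const p) (#pos μ ∷ conj N (map pred ν))
      ≈⟨ mulEs-leading μ (conj N (map pred ν)) ⟩
    mulEs (map pred μ) (const p) (conj N (map pred ν))
      ≈⟨ coefficient-lex N (map pred μ) (map pred ν) le (≢ ∘ cong₂ _∷_ μ≡ν) ⟩
    𝟎 ∎

  private module _ (N : ℕ) (a b : List ℕ → A) where

    expansion : (List ℕ → A) → List (List ℕ) → Ser
    expansion c ps α = ∑ ps (λ μ → mulEs μ (const (c μ)) α)

    _≻_ : List ℕ → List ℕ → Set
    μ ≻ ν = Lex-≤ _≡_ _<_ (conj N ν) (conj N μ) × conj N μ ≢ conj N ν

    expansion-head : ∀ c μ ps → All (_≤ N) μ → All (μ ≻_) ps →
                     expansion c (μ ∷ ps) (conj N μ) ≃ c μ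
    expansion-head c μ ps μ≤ μ≻ps = begin
      mulEs μ (const (c μ)) (conj N μ) ⊕ expansion c ps (conj N μ)
        ≈⟨ ⊕-cong (coefficient-conj N μ μ≤) (∑-cong-∈ ps (λ ν ν∈ps →
             let le , ≢ = All.lookup μ≻ps ν∈ps in coefficient-lex N ν μ le (≢ ∘ ≡.sym))) ⟩
      c μ ⊕ ∑ ps (λ _ → 𝟎)
        ≈⟨ ⊕-congˡ (∑-𝟎 ps) ⟩
      c μ ⊕ 𝟎
        ≈⟨ ⊕-identityʳ _ ⟩
      c μ ∎

    -- Triangular elimination: at the conjugate of the head all later partitions contribute nothing,
    -- which compares the two head coefficients. The head terms, now equal, are cancelled before the
    -- tail is treated.
    independent-sorted : ∀ ps → All (All (_≤ N)) ps → AllPairs _≻_ ps →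
      (∀ κ → κ ∈ ps → expansion a ps (conj N κ) ≃ expansion b ps (conj N κ)) →
      ∀ μ → μ ∈ ps → a μ ≃ b μ
    independent-sorted (μ ∷ ps) (μ≤ ∷ ps≤) (μ≻ps ∷ sorted) eq = go
      where
      aμ≃bμ : a μ ≃ b μ
      aμ≃bμ = ≃-trans (≃-sym (expansion-head a μ ps μ≤ μ≻ps))
        (≃-trans (eq μ (here refl)) (expansion-head b μ ps μ≤ μ≻ps))

      go : ∀ ν → ν ∈ μ ∷ ps → a ν ≃ b ν
      go ν (here refl)  = aμ≃bμ
      go ν (there ν∈ps) = independent-sorted ps ps≤ sorted (λ κ κ∈ps → ⊕-cancelˡ _ _ _ (≃-trans
        (⊕-congʳ (mulEs-cong μ (const-cong (≃-sym aμ≃bμ)) (conj N κ))) (eq κ (there κ∈ps)))) ν ν∈ps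

  -- The elimination evaluates the series only at conjugates of partitions of n + 1, which have
  -- degree n + 1, so that agreement in this degree suffices.
  independent : ∀ n (a b : List ℕ → A) ps → Unique ps → All (IsPartition (suc n)) ps →
    (∀ α → sum α ≡ suc n → ∑ ps (λ μ → mulEs μ (const (a μ)) α) ≃ ∑ ps (λ μ → mulEs μ (const (b μ)) α)) →
    ∀ μ → μ ∈ ps → a μ ≃ b μ
  independent n a b ps unique partitions eq μ μ∈ps =
    independent-sorted (suc n) a b qs
      (All.map partition-parts≤ qs-partitions)
      (AllPairs.zip (sorted , conj-distinct qs-partitions qs-unique))
      (λ κ κ∈qs → ≃-trans (∑-↭ (sort-↭ ps)) (≃-trans (eq (conj (suc n) κ) (degree κ κ∈qs))
        (≃-sym (∑-↭ (sort-↭ ps)))))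
      μ (∈-resp-↭ ps↭qs μ∈ps)
    where
    -- Flipped, so that sorting puts the lexicographically largest conjugate first. Its equality is
    -- equality of conjugates; strictness therefore comes from `conj-distinct`.
    order : DecTotalOrder 0ℓ 0ℓ 0ℓ
    order = On.decTotalOrder
      (Flip.decTotalOrder (Lex.≤-decTotalOrder ℕ.<-strictTotalOrder)) (conj (suc n))

    open Sort order using (sort; sort-↭; sort-↗)

    qs : List (List ℕ)
    qs = sort ps

    ps↭qs : ps ↭ qs
    ps↭qs = ↭-sym (sort-↭ ps)

    sorted : AllPairs (λ μ ν → Lex-≤ _≡_ _<_ (conj (suc n) ν) (conj (suc n) μ)) qs
    sorted = Linked.Linked⇒AllPairs
      (λ {μ} {ν} {κ} → DecTotalOrder.trans order {μ} {ν} {κ}) (sort-↗ ps)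

    qs-unique : Unique qs
    qs-unique = ↭ₛ.Unique-resp-↭ (≡.setoid (List ℕ)) (↭⇒↭ₛ ps↭qs) unique

    qs-partitions : All (IsPartition (suc n)) qs
    qs-partitions = All.tabulate (All.lookup partitions ∘ ∈-resp-↭ (sort-↭ ps))

    degree : ∀ κ → κ ∈ qs → sum (conj (suc n) κ) ≡ suc n
    degree κ κ∈qs with All.lookup qs-partitions κ∈qs
    ... | κ-partition@(_ , _ , sum≡) =
      ≡.trans (sum-conj (suc n) κ (partition-parts≤ κ-partition)) sum≡

    conj-distinct : ∀ {qs} → All (IsPartition (suc n)) qs → Unique qs →
               AllPairs (λ μ ν → conj (suc n) μ ≢ conj (suc n) ν) qs
    conj-distinct []       []       = []
    conj-distinct (p ∷ ps) (u ∷ us) =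
      All.zipWith (λ (q , ≢) → ≢ ∘ partition-conj-injective p q) (ps , u) ∷ conj-distinct ps us

-- Orientations of the path as bit vectors

module _ {A B : Set} (h : A → B) {P : B → Set} (P? : ∀ x → Dec (P x)) where

  does-all?-map : ∀ xs → does (all? P? (map h xs)) ≡ does (all? (P? ∘ h) xs)
  does-all?-map []       = refl
  does-all?-map (x ∷ xs) = cong (does (P? (h x)) ∧_) (does-all?-map xs)

  length-filter-map : ∀ xs → length (filter P? (map h xs)) ≡ length (filter (P? ∘ h) xs)
  length-filter-map []       = refl
  length-filter-map (x ∷ xs) with does (P? (h x))
  ... | true  = cong suc (length-filter-map xs)
  ... | false = length-filter-map xs

fsuc² : ∀ {n} → Arc n → Arc (suc n)
fsuc² = Product.map Fin.suc Fin.suc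

arcs-path-suc : ∀ n → arcs (path (suc (suc n))) ≡
                (Fin.zero , Fin.suc Fin.zero) ∷ map fsuc² (arcs (path (suc n)))
arcs-path-suc n = cong ((Fin.zero , Fin.suc Fin.zero) ∷_) (≡.trans (List.map-tabulate Fin.suc _)
  (≡.sym (≡.trans (cong (map fsuc²) (List.map-tabulate id _)) (List.map-tabulate _ fsuc²))))

firstEdge : ∀ {n} → Bool → Arc (suc (suc n))
firstEdge true  = Fin.zero , Fin.suc Fin.zero
firstEdge false = Fin.suc Fin.zero , Fin.zero

orient : ∀ {n} → Vec Bool n → List (Arc (suc n))
orient []      = []
orient (x ∷ b) = firstEdge x ∷ map fsuc² (orient b)

orientations-map : ∀ {n} (E : List (Arc n)) →
                   orientations (map fsuc² E) ≡ map (map fsuc²) (orientations E)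
orientations-map []       = refl
orientations-map (uv ∷ E) = ≡.trans
  (cong (cartesianProductWith _∷_ (fsuc² uv ∷ swap (fsuc² uv) ∷ [])) (orientations-map E))
  (distribute uv (swap uv) (orientations E))
  where
  prepend : ∀ uv as → map (fsuc² uv ∷_) (map (map fsuc²) as) ≡ map (map fsuc²) (map (uv ∷_) as)
  prepend uv as = ≡.trans (≡.sym (List.map-∘ as)) (List.map-∘ as)

  distribute : ∀ uv vu as →
    cartesianProductWith _∷_ (fsuc² uv ∷ fsuc² vu ∷ []) (map (map fsuc²) as) ≡
    map (map fsuc²) (cartesianProductWith _∷_ (uv ∷ vu ∷ []) as)
  distribute uv vu as = ≡.trans
    (cong₂ _++_ (prepend uv as) (cong (_++ []) (prepend vu as)))
    (≡.sym (≡.trans (List.map-++ (map fsuc²) (map (uv ∷_) as) _)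
      (cong (map (map fsuc²) (map (uv ∷_) as) ++_) (List.map-++ (map fsuc²) (map (vu ∷_) as) []))))

-- An equality of lists, since `bits` puts true before false just as `orientations` puts an edge
-- before its reverse.
orientations-path : ∀ n → orientations (arcs (path (suc n))) ≡ map orient (bits n)
orientations-path zero    = refl
orientations-path (suc n) = begin
  orientations (arcs (path (suc (suc n))))
    ≡⟨ cong orientations (arcs-path-suc n) ⟩
  cartesianProductWith _∷_ edges (orientations (map fsuc² (arcs (path (suc n)))))
    ≡⟨ cong (cartesianProductWith _∷_ edges) (≡.trans (orientations-map (arcs (path (suc n))))
         (cong (map (map fsuc²)) (orientations-path n))) ⟩
  cartesianProductWith _∷_ edges (map (map fsuc²) (map orient (bits n)))
    ≡⟨ cong₂ _++_ (prepend true) (cong (_++ []) (prepend false)) ⟩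
  map orient (map (true ∷_) (bits n)) ++ (map orient (map (false ∷_) (bits n)) ++ [])
    ≡⟨ cong (map orient (map (true ∷_) (bits n)) ++_) (List.map-++ orient (map (false ∷_) (bits n)) []) ⟨
  map orient (map (true ∷_) (bits n)) ++ map orient (map (false ∷_) (bits n) ++ [])
    ≡⟨ List.map-++ orient (map (true ∷_) (bits n)) _ ⟨
  map orient (bits (suc n)) ∎
  where
  open ≡-Reasoning
  edges = firstEdge true ∷ firstEdge false ∷ []

  prepend : ∀ x → map (firstEdge x ∷_) (map (map fsuc²) (map orient (bits n))) ≡
                  map orient (map (x ∷_) (bits n))
  prepend x = ≡.trans (≡.sym (List.map-∘ _)) (≡.trans (≡.sym (List.map-∘ (bits n))) (List.map-∘ (bits n)))

-- A height function that decreases along all edges excludes directed cycles.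
Descending : ∀ {n} → (Fin n → ℕ) → List (Arc n) → Set
Descending h = All (λ uv → h (proj₂ uv) < h (proj₁ uv))

Descending⇒Acyclic : ∀ {n} (h : Fin n → ℕ) a → Descending h a → Acyclic a
Descending⇒Acyclic h a desc v cycle = ℕ.<-irrefl refl (decrease cycle)
  where
  decrease : ∀ {u v} → TransClosure (a ⊢_⟶_) u v → h v < h u
  decrease [ uv ]     = All.lookup desc uv
  decrease (uv ∷ vw)  = ℕ.<-trans (decrease vw) (All.lookup desc uv)

-- An edge to the left raises all vertices on its right by one. The result is in general not the
-- length of a longest directed path, but it decreases along every edge.
height : ∀ {n} → Vec Bool n → Fin (suc n) → ℕ
height []          _           = 0
height (true ∷ b)  Fin.zero    = suc (height b Fin.zero)
height (true ∷ b)  (Fin.suc i) = height b i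
height (false ∷ b) Fin.zero    = 0
height (false ∷ b) (Fin.suc i) = suc (height b i)

height-Descending : ∀ {n} (b : Vec Bool n) → Descending (height b) (orient b)
height-Descending []          = []
height-Descending (true ∷ b)  = ℕ.n<1+n _ ∷ All.map⁺ (height-Descending b)
height-Descending (false ∷ b) = z<s ∷ All.map⁺ (All.map s<s (height-Descending b))

orient-acyclic : ∀ {n} (b : Vec Bool n) → Acyclic (orient b)
orient-acyclic b = Descending⇒Acyclic (height b) (orient b) (height-Descending b)

ascₒ-orient : ∀ {n} (b : Vec Bool n) → ascₒ (path (suc n)) (orient b) ≡ trues b
ascₒ-orient []                = refl
ascₒ-orient {suc n} (x ∷ b) = ≡.trans
  (cong (length ∘ filter (_∈? orient (x ∷ b))) (arcs-path-suc n)) (first-edge x)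
  where
  ∈-tail : ∀ x {uv} → fsuc² uv ∈ orient (x ∷ b) → uv ∈ orient b
  ∈-tail true  (here ())
  ∈-tail false (here ())
  ∈-tail x     (there ∈map) with ∈-map⁻ fsuc² ∈map
  ... | _ , uv∈ , refl = uv∈

  tail-count : ∀ x → length (filter (_∈? orient (x ∷ b)) (map fsuc² (arcs (path (suc n))))) ≡ trues b
  tail-count x = ≡.trans (length-filter-map fsuc² (_∈? orient (x ∷ b)) (arcs (path (suc n))))
    (≡.trans (cong length (List.filter-≐ (λ uv → fsuc² uv ∈? orient (x ∷ b)) (_∈? orient b)
      (∈-tail x , there ∘ ∈-map⁺ fsuc²) (arcs (path (suc n))))) (ascₒ-orient b))

  first-edge : ∀ x → length (filter (_∈? orient (x ∷ b)) (firstEdge true ∷ map fsuc² (arcs (path (suc n))))) ≡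
                     trues (x ∷ b)
  first-edge true  = ≡.trans
    (cong length (List.filter-accept (_∈? orient (true ∷ b)) {xs = map fsuc² (arcs (path (suc n)))} (here refl)))
    (cong suc (tail-count true))
  first-edge false = ≡.trans
    (cong length (List.filter-reject (_∈? orient (false ∷ b)) {xs = map fsuc² (arcs (path (suc n)))} not-an-edge))
    (tail-count false)
    where
    not-an-edge : ¬ (firstEdge true ∈ orient (false ∷ b))
    not-an-edge (here ())
    not-an-edge (there ∈map) with ∈-map⁻ fsuc² ∈map
    ... | _ , _ , ()

-- Sinks and gaps of an encoded orientation

-- The sinks at positions i, i + 1, …, where the vertex at position i is
-- excluded if p is false.
sinksFrom : ∀ {n} → Bool → ℕ → Vec Bool n → List ℕ
sinksFrom true  i []          = i ∷ []
sinksFrom false i []          = []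
sinksFrom p     i (true ∷ b)  = sinksFrom true (suc i) b
sinksFrom true  i (false ∷ b) = i ∷ sinksFrom false (suc i) b
sinksFrom false i (false ∷ b) = sinksFrom false (suc i) b

-- Remembers the edge that has been cut off on the left: for p false it leaves the first remaining
-- vertex, which may be a sink of the remaining path but not of the whole one.
Admissible : ∀ {n} → Bool → Fin n → Set
Admissible true  _ = ⊤
Admissible false s = toℕ s ≢ 0

admissible? : ∀ {n} p (s : Fin n) → Dec (Admissible p s)
admissible? true  s = yes tt
admissible? false s = ¬? (toℕ s ℕ.≟ 0)

admissibleSink? : ∀ {n} p (a : List (Arc n)) s → Dec (Admissible p s × Sink a s)
admissibleSink? p a s = admissible? p s ×-dec sink? a s

filter-map : ∀ {A B : Set} (h : A → B) {P : B → Set} (P? : ∀ x → Dec (P x)) xs →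
             filter P? (map h xs) ≡ map h (filter (P? ∘ h) xs)
filter-map h P? []       = refl
filter-map h P? (x ∷ xs) with does (P? (h x))
... | true  = cong (h x ∷_) (filter-map h P? xs)
... | false = filter-map h P? xs

sinksFrom-orient : ∀ {n} p i (b : Vec Bool n) →
  map (λ s → i + toℕ s) (filter (admissibleSink? p (orient b)) (allFin (suc n))) ≡ sinksFrom p i b
sinksFrom-orient true  i [] = cong (_∷ []) (ℕ.+-identityʳ i)
sinksFrom-orient false i [] = refl
sinksFrom-orient {suc n} p i (x ∷ b) = ≡.trans
  (cong (λ ss → map (λ s → i + toℕ s) (filter (admissibleSink? p (orient (x ∷ b))) (Fin.zero ∷ ss)))
    (≡.sym (List.map-tabulate id Fin.suc)))
  (first p x)
  where
  Sink-suc : ∀ {s} x → proj₁ (firstEdge x) ≢ Fin.suc s →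
             Sink (orient b) s → Sink (orient (x ∷ b)) (Fin.suc s)
  Sink-suc x ≢s sink = ≢s ∷ All.map⁺ (All.map (_∘ Fin.suc-injective) sink)

  Sink-suc⁻ : ∀ {s} x → Sink (orient (x ∷ b)) (Fin.suc s) → Sink (orient b) s
  Sink-suc⁻ x (_ ∷ sink) = All.map (_∘ cong Fin.suc) (All.map⁻ sink)

  positive : ∀ {n} p {s : Fin n} → Admissible p (Fin.suc s)
  positive true  = tt
  positive false = λ ()

  -- The bit of the removed edge becomes the admissibility of the next vertex: a true bit enters
  -- that vertex, a false bit leaves it.
  equivalent : ∀ p x → (λ s → Admissible p (Fin.suc s) × Sink (orient (x ∷ b)) (Fin.suc s)) ≐
                       (λ s → Admissible x s × Sink (orient b) s)
  equivalent p true  = (λ (_ , sink) → tt , Sink-suc⁻ true sink) ,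
                       (λ (_ , sink) → positive p , Sink-suc true (λ ()) sink)
  equivalent p false = (λ { (_ , sink@(≢s ∷ _)) → ≢s ∘ cong Fin.suc ∘ ≡.sym ∘ Fin.toℕ-injective , Sink-suc⁻ false sink }) ,
                       (λ (s≢0 , sink) → positive p ,
                          Sink-suc false (s≢0 ∘ cong toℕ ∘ ≡.sym ∘ Fin.suc-injective) sink)

  rest : ∀ p x → map (λ s → i + toℕ s)
           (filter (admissibleSink? p (orient (x ∷ b))) (map Fin.suc (allFin (suc n)))) ≡
         sinksFrom x (suc i) b
  rest p x = begin
    map (λ s → i + toℕ s) (filter (admissibleSink? p (orient (x ∷ b))) (map Fin.suc (allFin (suc n))))
      ≡⟨ cong (map (λ s → i + toℕ s)) (filter-map Fin.suc (admissibleSink? p (orient (x ∷ b))) (allFin (suc n))) ⟩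
    map (λ s → i + toℕ s) (map Fin.suc
      (filter (λ s → admissibleSink? p (orient (x ∷ b)) (Fin.suc s)) (allFin (suc n))))
      ≡⟨ List.map-∘ _ ⟨
    map (λ s → i + suc (toℕ s))
      (filter (λ s → admissibleSink? p (orient (x ∷ b)) (Fin.suc s)) (allFin (suc n)))
      ≡⟨ List.map-cong (λ s → ℕ.+-suc i (toℕ s)) _ ⟩
    map (λ s → suc i + toℕ s)
      (filter (λ s → admissibleSink? p (orient (x ∷ b)) (Fin.suc s)) (allFin (suc n)))
      ≡⟨ cong (map (λ s → suc i + toℕ s)) (List.filter-≐ (λ s → admissibleSink? p (orient (x ∷ b)) (Fin.suc s))
           (admissibleSink? x (orient b)) (equivalent p x) (allFin (suc n))) ⟩
    map (λ s → suc i + toℕ s) (filter (admissibleSink? x (orient b)) (allFin (suc n)))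
      ≡⟨ sinksFrom-orient x (suc i) b ⟩
    sinksFrom x (suc i) b ∎
      where open ≡-Reasoning

  accept : ∀ p x → Admissible {suc (suc n)} p Fin.zero × Sink (orient (x ∷ b)) Fin.zero →
    map (λ s → i + toℕ s)
      (filter (admissibleSink? p (orient (x ∷ b))) (Fin.zero ∷ map Fin.suc (allFin (suc n)))) ≡
    i ∷ sinksFrom x (suc i) b
  accept p x sink = ≡.trans
    (cong (map (λ s → i + toℕ s)) (List.filter-accept (admissibleSink? p (orient (x ∷ b))) sink))
    (cong₂ _∷_ (ℕ.+-identityʳ i) (rest p x))

  reject : ∀ p x → ¬ (Admissible {suc (suc n)} p Fin.zero × Sink (orient (x ∷ b)) Fin.zero) →
    map (λ s → i + toℕ s)
      (filter (admissibleSink? p (orient (x ∷ b))) (Fin.zero ∷ map Fin.suc (allFin (suc n)))) ≡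
    sinksFrom x (suc i) b
  reject p x ¬sink = ≡.trans
    (cong (map (λ s → i + toℕ s)) (List.filter-reject (admissibleSink? p (orient (x ∷ b))) ¬sink))
    (rest p x)

  first : ∀ p x → map (λ s → i + toℕ s)
      (filter (admissibleSink? p (orient (x ∷ b))) (Fin.zero ∷ map Fin.suc (allFin (suc n)))) ≡
    sinksFrom p i (x ∷ b)
  first true  true  = reject true true (λ { (_ , ≢0 ∷ _) → ≢0 refl })
  first false true  = reject false true (λ { (_ , ≢0 ∷ _) → ≢0 refl })
  first true  false = accept true false (tt , (λ ()) ∷ All.map⁺ (All.universal (λ _ ()) (orient b)))
  first false false = reject false false (λ { (≢0 , _) → ≢0 refl })

sinks-orient : ∀ {n} (b : Vec Bool n) → sinks (orient b) ≡ sinksFrom true 1 b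
sinks-orient {n} b = ≡.trans
  (cong (map (suc ∘ toℕ)) (List.filter-≐ (sink? (orient b)) (admissibleSink? true (orient b))
    ((λ sink → tt , sink) , proj₂) (allFin (suc n))))
  (sinksFrom-orient true 1 b)

gap≡ : ∀ s g i → i ≡ suc (s + g) → i ∸ s ∸ 1 ≡ g
gap≡ s g i i≡ = cong (_∸ 1) (≡.trans (cong (_∸ s) (≡.trans i≡ (≡.sym (ℕ.+-suc s g)))) (ℕ.m+n∸m≡n s (suc g)))

-- Here i = s + g + 1 is the current position, s being the last sink.
gapsFrom-down : ∀ {k} n r s g i (b : Vec Bool k) → i ≡ suc (s + g) → n ≡ i + k →
  ((r + (n ∸ last s (sinksFrom false i b))) ∷ between (s ∷ sinksFrom false i b)) ↭ down r g b
gapsFrom-up : ∀ {k} n r s g i (b : Vec Bool k) → i ≡ suc (s + g) → n ≡ i + k →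
  ((r + (n ∸ last s (sinksFrom true i b))) ∷ between (s ∷ sinksFrom true i b)) ↭ up r g b

gapsFrom-down n r s g i []          i≡ n≡ = ↭-reflexive (cong (λ m → (r + m) ∷ []) (begin
  n ∸ s            ≡⟨ cong (_∸ s) (≡.trans n≡ (ℕ.+-identityʳ i)) ⟩
  i ∸ s            ≡⟨ cong (_∸ s) (≡.trans i≡ (≡.sym (ℕ.+-suc s g))) ⟩
  (s + suc g) ∸ s  ≡⟨ ℕ.m+n∸m≡n s (suc g) ⟩
  suc g            ∎))
  where open ≡-Reasoning
gapsFrom-down {suc k} n r s g i (true ∷ b)  i≡ n≡ =
  gapsFrom-up n r s (suc g) (suc i) b (cong suc (≡.trans i≡ (≡.sym (ℕ.+-suc s g)))) (≡.trans n≡ (ℕ.+-suc i k))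
gapsFrom-down {suc k} n r s g i (false ∷ b) i≡ n≡ =
  gapsFrom-down n r s (suc g) (suc i) b (cong suc (≡.trans i≡ (≡.sym (ℕ.+-suc s g)))) (≡.trans n≡ (ℕ.+-suc i k))

gapsFrom-up n r s g i []          i≡ n≡ = ↭-trans
  (↭-reflexive (cong₂ (λ m h → (r + m) ∷ h ∷ []) n∸i≡0 (gap≡ s g i i≡)))
  (↭-trans (↭-reflexive (cong (λ m → m ∷ g ∷ []) (ℕ.+-identityʳ r))) (↭.swap r g ↭.refl))
  where
  n∸i≡0 : n ∸ i ≡ 0
  n∸i≡0 = ≡.trans (cong (_∸ i) (≡.trans n≡ (ℕ.+-identityʳ i))) (ℕ.n∸n≡0 i)
gapsFrom-up {suc k} n r s g i (true ∷ b)  i≡ n≡ =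
  gapsFrom-up n r s (suc g) (suc i) b (cong suc (≡.trans i≡ (≡.sym (ℕ.+-suc s g)))) (≡.trans n≡ (ℕ.+-suc i k))
-- The current vertex i is a sink here. `gaps` lists the outer gap first, whereas `up` emits an
-- inner gap as soon as it is closed, hence the exchange of the two heads.
gapsFrom-up {suc k} n r s g i (false ∷ b) i≡ n≡ = ↭-trans (↭.swap _ _ ↭.refl)
  (↭-trans (↭-reflexive (cong (_∷ _) (gap≡ s g i i≡)))
    (↭.prep g (gapsFrom-down n r i 0 (suc i) b (cong suc (≡.sym (ℕ.+-identityʳ i))) (≡.trans n≡ (ℕ.+-suc i k)))))

gaps-initial : ∀ {k} n r (b : Vec Bool k) → n ≡ suc r + k →
               gaps n (sinksFrom true (suc r) b) ↭ initial r b
gaps-initial n r []          n≡ = ↭-reflexive (cong (_∷ []) (≡.trans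
  (cong (r +_) (≡.trans (cong (_∸ suc r) (≡.trans n≡ (ℕ.+-identityʳ (suc r)))) (ℕ.n∸n≡0 (suc r))))
  (ℕ.+-identityʳ r)))
gaps-initial {suc k} n r (true ∷ b)  n≡ = gaps-initial n (suc r) b (≡.trans n≡ (ℕ.+-suc (suc r) k))
gaps-initial {suc k} n r (false ∷ b) n≡ = gapsFrom-down n r (suc r) 0 (suc (suc r)) b
  (cong suc (≡.sym (ℕ.+-identityʳ (suc r)))) (≡.trans n≡ (ℕ.+-suc (suc r) k))

gaps-orient : ∀ {n} (b : Vec Bool n) → gaps (suc n) (sinks (orient b)) ↭ initial 0 b
gaps-orient {n} b = ↭-trans (↭-reflexive (cong (gaps (suc n)) (sinks-orient b))) (gaps-initial (suc n) 0 b refl)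

-- Both sides count vertices: r before the first sink, the last sink, g after it, the current vertex
-- and the k still to come. Gaps closed earlier have already been emitted.
sum-down : ∀ {k} r g (b : Vec Bool k) → sum (map suc (down r g b)) ≡ suc (r + suc g) + k
sum-up : ∀ {k} r g (b : Vec Bool k) → sum (map suc (up r g b)) ≡ suc (r + suc g) + k
sum-down         r g []          = refl
sum-down {suc k} r g (true ∷ b)  = ≡.trans (sum-up r (suc g) b)
  (≡.trans (cong (λ m → suc m + k) (ℕ.+-suc r (suc g))) (≡.sym (ℕ.+-suc (suc (r + suc g)) k)))
sum-down {suc k} r g (false ∷ b) = ≡.trans (sum-down r (suc g) b)
  (≡.trans (cong (λ m → suc m + k) (ℕ.+-suc r (suc g))) (≡.sym (ℕ.+-suc (suc (r + suc g)) k)))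
sum-up         r g []          = begin
  suc (g + suc (r + 0))  ≡⟨ cong (λ m → suc (g + suc m)) (ℕ.+-identityʳ r) ⟩
  suc (g + suc r)        ≡⟨ cong suc (ℕ.+-suc g r) ⟩
  suc (suc (g + r))      ≡⟨ cong (suc ∘ suc) (ℕ.+-comm g r) ⟩
  suc (suc (r + g))      ≡⟨ cong suc (ℕ.+-suc r g) ⟨
  suc (r + suc g)        ≡⟨ ℕ.+-identityʳ _ ⟨
  suc (r + suc g) + 0    ∎
  where open ≡-Reasoning
sum-up {suc k} r g (true ∷ b)  = ≡.trans (sum-up r (suc g) b)
  (≡.trans (cong (λ m → suc m + k) (ℕ.+-suc r (suc g))) (≡.sym (ℕ.+-suc (suc (r + suc g)) k)))
sum-up {suc k} r g (false ∷ b) = begin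
  suc g + sum (map suc (down r 0 b)) ≡⟨ cong (suc g +_) (sum-down r 0 b) ⟩
  suc g + (suc (r + 1) + k)          ≡⟨ cong (λ m → suc g + (suc m + k)) (ℕ.+-comm r 1) ⟩
  suc g + (suc (suc r) + k)          ≡⟨ cong (suc g +_) (ℕ.+-suc (suc r) k) ⟨
  suc g + (suc r + suc k)            ≡⟨ ℕ.+-assoc (suc g) (suc r) (suc k) ⟨
  suc g + suc r + suc k              ≡⟨ cong (λ m → m + suc k) (≡.trans (ℕ.+-comm (suc g) (suc r)) refl) ⟩
  suc (r + suc g) + suc k            ∎
  where open ≡-Reasoning

sum-initial : ∀ {k} r (b : Vec Bool k) → sum (map suc (initial r b)) ≡ suc r + k
sum-initial         r []          = refl
sum-initial {suc k} r (true ∷ b)  = ≡.trans (sum-initial (suc r) b) (≡.sym (ℕ.+-suc (suc r) k))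
sum-initial {suc k} r (false ∷ b) = ≡.trans (sum-down r 0 b)
  (≡.trans (cong (λ m → suc m + k) (ℕ.+-comm r 1)) (≡.sym (ℕ.+-suc (suc r) k)))

-- Polynomials as coefficients and products with e_k

coeff-+ₚ : ∀ p q k → coeff (p +ₚ q) k ≡ coeff p k +ℚ coeff q k
coeff-+ₚ []      q       k       = ≡.sym (ℚ.+-identityˡ _)
coeff-+ₚ (a ∷ p) []      k       = ≡.sym (ℚ.+-identityʳ _)
coeff-+ₚ (a ∷ p) (b ∷ q) zero    = refl
coeff-+ₚ (a ∷ p) (b ∷ q) (suc k) = coeff-+ₚ p q k

coeff-map : ∀ a q k → coeff (map (a *ℚ_) q) k ≡ a *ℚ coeff q k
coeff-map a []      k       = ≡.sym (ℚ.*-zeroʳ a)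
coeff-map a (b ∷ q) zero    = refl
coeff-map a (b ∷ q) (suc k) = coeff-map a q k

-- _≈_ unfolds, so that Agda could not infer the polynomials from it.
infix 4 _≋_
record _≋_ (p q : Poly) : Set where
  constructor mk≋
  field coeffs : p ≈ q
open _≋_

+ₚ-0-commutativeMonoid : CommutativeMonoid 0ℓ 0ℓ
+ₚ-0-commutativeMonoid = record
  { Carrier = Poly ; _≈_ = _≋_ ; _∙_ = _+ₚ_ ; ε = []
  ; isCommutativeMonoid = record
    { isMonoid = record
      { isSemigroup = record
        { isMagma = record
          { isEquivalence = record
            { refl  = mk≋ λ _ → refl
            ; sym   = λ (mk≋ e) → mk≋ λ k → ≡.sym (e k)
            ; trans = λ (mk≋ e) (mk≋ f) → mk≋ λ k → ≡.trans (e k) (f k) }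
          ; ∙-cong = λ {p} {p′} {q} {q′} (mk≋ e) (mk≋ f) → mk≋ λ k → ≡.trans (coeff-+ₚ p q k)
              (≡.trans (cong₂ _+ℚ_ (e k) (f k)) (≡.sym (coeff-+ₚ p′ q′ k))) }
        ; assoc = λ p q r → mk≋ λ k → ≡.trans (coeff-+ₚ (p +ₚ q) r k)
            (≡.trans (cong (_+ℚ coeff r k) (coeff-+ₚ p q k)) (≡.trans (ℚ.+-assoc (coeff p k) _ _)
            (≡.sym (≡.trans (coeff-+ₚ p (q +ₚ r) k) (cong (coeff p k +ℚ_) (coeff-+ₚ q r k)))))) }
      ; identity = (λ p → mk≋ λ k → refl) , (λ p → mk≋ λ k → ≡.trans (coeff-+ₚ p [] k) (ℚ.+-identityʳ _)) }
    ; comm = λ p q → mk≋ λ k → ≡.trans (coeff-+ₚ p q k)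
        (≡.trans (ℚ.+-comm (coeff p k) _) (≡.sym (coeff-+ₚ q p k))) } }

open SeriesOver +ₚ-0-commutativeMonoid

+ₚ-cancelˡ : ∀ r p q → r +ₚ p ≋ r +ₚ q → p ≋ q
+ₚ-cancelˡ r p q (mk≋ e) = mk≋ λ k →
  Group.∙-cancelˡ ℚ.+-0-group (coeff r k) (coeff p k) (coeff q k)
    (≡.trans (≡.sym (coeff-+ₚ r p k)) (≡.trans (e k) (coeff-+ₚ r q k)))

t·_ : Poly → Poly
t· p = 0ℚ ∷ p

t·-additive : Additive t·_
t·-additive = record
  { f-cong = λ (mk≋ e) → mk≋ λ { zero → refl ; (suc k) → e k }
  ; f-⊕    = λ p q → mk≋ λ { zero → refl ; (suc k) → refl }
  ; f-𝟎    = mk≋ λ { zero → refl ; (suc k) → refl } }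

map-*-additive : ∀ a → Additive (map (a *ℚ_))
map-*-additive a = record
  { f-cong = λ {p} {q} (mk≋ e) → mk≋ λ k →
      ≡.trans (coeff-map a p k) (≡.trans (cong (a *ℚ_) (e k)) (≡.sym (coeff-map a q k)))
  ; f-⊕    = λ p q → mk≋ λ k → ≡.trans (coeff-map a (p +ₚ q) k) (≡.trans (cong (a *ℚ_) (coeff-+ₚ p q k))
      (≡.trans (ℚ.*-distribˡ-+ a (coeff p k) (coeff q k)) (≡.sym (≡.trans (coeff-+ₚ (map (a *ℚ_) p) _ k)
        (cong₂ _+ℚ_ (coeff-map a p k) (coeff-map a q k))))))
  ; f-𝟎    = ≃-refl }

*ₚ-additive : ∀ p → Additive (p *ₚ_)
*ₚ-additive []      = 𝟎-additive
*ₚ-additive (a ∷ p) = ⊕-additive (map-*-additive a) (∘-additive t·-additive (*ₚ-additive p))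

*ₚ-identityʳ : ∀ p → p *ₚ t^ 0 ≋ p
*ₚ-identityʳ []      = ≃-refl
*ₚ-identityʳ (a ∷ p) = mk≋ λ
  { zero    → ≡.trans (ℚ.+-identityʳ _) (ℚ.*-identityʳ a)
  ; (suc k) → coeffs (*ₚ-identityʳ p) k }

*ₚ-identityˡ : ∀ p → t^ 0 *ₚ p ≋ p
*ₚ-identityˡ p = ≃-trans (⊕-congˡ (f-𝟎 t·-additive)) (≃-trans (⊕-identityʳ _)
  (mk≋ λ k → ≡.trans (coeff-map 1ℚ p k) (ℚ.*-identityˡ _)))

sumₚ-map : ∀ {I : Set} (f : I → Poly) xs → sumₚ (map f xs) ≡ ∑ xs f
sumₚ-map f []       = refl
sumₚ-map f (x ∷ xs) = cong (f x +ₚ_) (sumₚ-map f xs)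

-- Products with e k

e-zero-one : ∀ a α → e 0 (suc a ∷ α) ≡ []
e-zero-one a α = cong (if_then t^ 0 else []) (∧-zeroʳ (does (all? (ℕ._≤? 1) (suc a ∷ α))))

e*ₛ≃mulE : ∀ k G α → (e k *ₛ G) α ≃ mulE k G α
e*ₛ≃mulE k G α = ≃-trans (≃-reflexive (sumₚ-map _ (factorizations α))) (product k α G)
  where
  ∑-factorizations : Monomial → (Monomial → Monomial → Poly) → Poly
  ∑-factorizations α h = ∑ (factorizations α) (λ (β , γ) → h β γ)

  ∑-factorizations-∷ : ∀ a α h → ∑-factorizations (a ∷ α) h ≃
    ∑ (upTo (suc a)) (λ i → ∑-factorizations α (λ β γ → h (i ∷ β) (a ∸ i ∷ γ)))
  ∑-factorizations-∷ a α h = ∑-cartesianProductWith _ (upTo (suc a)) (factorizations α)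

  vanish : ∀ α h → (∀ β γ → h β γ ≃ []) → ∑-factorizations α h ≃ []
  vanish α h h≃𝟎 = ≃-trans (∑-cong (factorizations α) (λ (β , γ) → h≃𝟎 β γ)) (∑-𝟎 (factorizations α))

  term : ℕ → ∀ a α → Ser → ℕ → Poly
  term k a α G i = ∑-factorizations α (λ β γ → e k (i ∷ β) *ₚ G (a ∸ i ∷ γ))

  product : ∀ k α G → ∑-factorizations α (λ β γ → e k β *ₚ G γ) ≃ mulE k G α
  product zero    []          G = ≃-trans (⊕-identityʳ _) (*ₚ-identityˡ (G []))
  product (suc k) []          G = ≃-refl
  product zero    (zero ∷ α)  G = ≃-trans (∑-factorizations-∷ 0 α (λ β γ → e 0 β *ₚ G γ))
    (≃-trans (⊕-identityʳ _) (product 0 α (λ γ → G (0 ∷ γ))))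
  product (suc k) (zero ∷ α)  G = ≃-trans (∑-factorizations-∷ 0 α (λ β γ → e (suc k) β *ₚ G γ))
    (≃-trans (⊕-identityʳ _) (product (suc k) α (λ γ → G (0 ∷ γ))))
  product zero    (suc a ∷ α) G = begin
    ∑-factorizations (suc a ∷ α) (λ β γ → e 0 β *ₚ G γ)
      ≈⟨ ∑-factorizations-∷ (suc a) α (λ β γ → e 0 β *ₚ G γ) ⟩
    ∑ (upTo (suc (suc a))) (term 0 (suc a) α G)
      ≈⟨ ∑-upTo-suc (suc a) {term 0 (suc a) α G} ⟩
    ∑-factorizations α (λ β γ → e 0 β *ₚ G (suc a ∷ γ)) ⊕
      ∑ (upTo (suc a)) (λ i → ∑-factorizations α (λ β γ → e 0 (suc i ∷ β) *ₚ G (a ∸ i ∷ γ)))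
      ≈⟨ ⊕-cong (product 0 α (λ γ → G (suc a ∷ γ))) (≃-trans (∑-cong (upTo (suc a)) λ i → vanish α _ λ β γ →
           ≃-reflexive (cong (_*ₚ G (a ∸ i ∷ γ)) (e-zero-one i β))) (∑-𝟎 (upTo (suc a)))) ⟩
    G (suc a ∷ α) ⊕ []
      ≈⟨ ⊕-identityʳ _ ⟩
    G (suc a ∷ α) ∎
  product (suc k) (suc a ∷ α) G = begin
    ∑-factorizations (suc a ∷ α) (λ β γ → e (suc k) β *ₚ G γ)
      ≈⟨ ∑-factorizations-∷ (suc a) α (λ β γ → e (suc k) β *ₚ G γ) ⟩
    ∑ (upTo (suc (suc a))) (term (suc k) (suc a) α G)
      ≈⟨ ∑-upTo-suc² a {term (suc k) (suc a) α G} ⟩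
    -- By computation, exponent 0 of x₁ in the first factor leaves e_{k+1}, exponent 1 leaves e_k,
    -- and larger exponents give the zero polynomial.
    ∑-factorizations α (λ β γ → e (suc k) β *ₚ G (suc a ∷ γ)) ⊕
      (∑-factorizations α (λ β γ → e k β *ₚ G (a ∷ γ)) ⊕
       ∑ (upTo a) (λ i → ∑-factorizations α (λ β γ → [])))
      ≈⟨ ⊕-cong (product (suc k) α (λ γ → G (suc a ∷ γ))) (≃-trans
           (⊕-cong (product k α (λ γ → G (a ∷ γ)))
                   (≃-trans (∑-cong (upTo a) λ i → ∑-𝟎 (factorizations α)) (∑-𝟎 (upTo a))))
           (⊕-identityʳ _)) ⟩
    mulE (suc k) (λ γ → G (suc a ∷ γ)) α ⊕ mulE k (λ γ → G (a ∷ γ)) α ∎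

e[]≃mulEs : ∀ ks α → e[ ks ] α ≃ mulEs ks (e 0) α
e[]≃mulEs []       α = ≃-refl
e[]≃mulEs (k ∷ ks) α = ≃-trans (e*ₛ≃mulE k e[ ks ] α) (mulE-cong k α (e[]≃mulEs ks))

-- Moves the scalar into the innermost constant, where the series over a monoid carry their
-- coefficients.
·-e[]≃mulEs : ∀ c ks α → (c · e[ ks ]) α ≃ mulEs ks (const c) α
·-e[]≃mulEs c ks α = begin
  c *ₚ e[ ks ] α                 ≈⟨ f-cong (*ₚ-additive c) (e[]≃mulEs ks α) ⟩
  c *ₚ mulEs ks (e 0) α          ≈⟨ mulEs-additive (*ₚ-additive c) ks α ⟨
  mulEs ks (λ β → c *ₚ e 0 β) α  ≈⟨ mulEs-cong ks scale α ⟩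
  mulEs ks (const c) α           ∎
  where
  scale : ∀ β → c *ₚ e 0 β ≃ const c β
  scale []          = *ₚ-identityʳ c
  scale (zero ∷ β)  = scale β
  scale (suc b ∷ β) = ≃-trans (≃-reflexive (cong (c *ₚ_) (e-zero-one b β))) (f-𝟎 (*ₚ-additive c))

-- Proper colorings as words

open GradedSeries +ₚ-0-commutativeMonoid t·_ t·-additive (t^ 0)

pow-one : ∀ k → pow k (t^ 0) ≡ t^ k
pow-one zero    = refl
pow-one (suc k) = cong t·_ (pow-one k)

-- Improper colorings are kept with weight zero, so that sums run over all words and split by their
-- first letter.
colorTerm : ∀ {n} → Coloring (suc n) → Poly
colorTerm {n} κ = if does (proper? (path (suc n)) κ) then t^ asc (path (suc n)) κ else []

step-ascent : ∀ {c d} → c < d → ∀ p → step c d p ≡ t· p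
step-ascent {zero}  {suc d} _         p = refl
step-ascent {suc c} {suc d} (s≤s c<d) p = step-ascent c<d p

step-descent : ∀ {c d} → d < c → ∀ p → step c d p ≡ p
step-descent {suc c} {zero}  _         p = refl
step-descent {suc c} {suc d} (s≤s d<c) p = step-descent d<c p

step-equal : ∀ c p → step c c p ≡ []
step-equal zero    p = refl
step-equal (suc c) p = step-equal c p

colorTerm-∷ : ∀ {n} c d (κ : Coloring n) →
              colorTerm (suc c ∷ suc d ∷ κ) ≃ step c d (colorTerm (suc d ∷ κ))
colorTerm-∷ {n} c d κ = ≃-trans
  (≃-reflexive (cong₂ (λ b k → if b then t^ k else []) proper-∷ asc-∷)) by-comparison
  where
  tail = suc d ∷ κ

  edge-proper? : ∀ {m} (κ : Coloring m) (uv : Arc m) →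
                 Dec (Vec.lookup κ (proj₁ uv) ≢ Vec.lookup κ (proj₂ uv))
  edge-proper? κ (u , v) = ¬? (Vec.lookup κ u ℕ.≟ Vec.lookup κ v)

  edge-ascent? : ∀ {m} (κ : Coloring m) (uv : Arc m) →
                 Dec (Vec.lookup κ (proj₁ uv) < Vec.lookup κ (proj₂ uv))
  edge-ascent? κ (u , v) = Vec.lookup κ u ℕ.<? Vec.lookup κ v

  proper-∷ : does (proper? (path (suc (suc n))) (suc c ∷ tail)) ≡
             does (¬? (suc c ℕ.≟ suc d)) ∧ does (proper? (path (suc n)) tail)
  proper-∷ = ≡.trans
    (cong (λ E → does (all? (edge-proper? (suc c ∷ tail)) E)) (arcs-path-suc n))
    (cong (does (¬? (suc c ℕ.≟ suc d)) ∧_)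
      (does-all?-map fsuc² (edge-proper? (suc c ∷ tail)) (arcs (path (suc n)))))

  asc-∷ : asc (path (suc (suc n))) (suc c ∷ tail) ≡
          (if does (suc c ℕ.<? suc d) then suc else id) (asc (path (suc n)) tail)
  asc-∷ = ≡.trans
    (cong (λ E → length (filter (edge-ascent? (suc c ∷ tail)) E)) (arcs-path-suc n)) first-edge
    where
    first-edge : length (filter (edge-ascent? (suc c ∷ tail))
                   ((Fin.zero , Fin.suc Fin.zero) ∷ map fsuc² (arcs (path (suc n))))) ≡
                 (if does (suc c ℕ.<? suc d) then suc else id) (asc (path (suc n)) tail)
    first-edge with does (suc c ℕ.<? suc d)
    ... | true  = cong suc (length-filter-map fsuc² (edge-ascent? (suc c ∷ tail)) (arcs (path (suc n))))
    ... | false = length-filter-map fsuc² (edge-ascent? (suc c ∷ tail)) (arcs (path (suc n)))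

  by-comparison :
    (if does (¬? (suc c ℕ.≟ suc d)) ∧ does (proper? (path (suc n)) tail)
     then t^ (if does (suc c ℕ.<? suc d) then suc else id) (asc (path (suc n)) tail) else [])
    ≃ step c d (colorTerm tail)
  by-comparison with ℕ.<-cmp c d
  ... | tri< c<d c≢d _
    rewrite step-ascent c<d (colorTerm tail)
          | dec-false (suc c ℕ.≟ suc d) (c≢d ∘ ℕ.suc-injective)
          | dec-true (suc c ℕ.<? suc d) (s≤s c<d)
    with does (proper? (path (suc n)) tail)
  ...   | true  = ≃-refl
  ...   | false = ≃-sym (f-𝟎 t·-additive)
  by-comparison | tri≈ _ refl _
    rewrite step-equal c (colorTerm tail) | dec-true (suc c ℕ.≟ suc c) refl = ≃-refl
  by-comparison | tri> c≮d c≢d d<c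
    rewrite step-descent d<c (colorTerm tail)
          | dec-false (suc c ℕ.≟ suc d) (c≢d ∘ ℕ.suc-injective)
          | dec-false (suc c ℕ.<? suc d) (c≮d ∘ ℕ.≤-pred) = ≃-refl

-- The series p x^f, where x^f = x₁^(f 0) x₂^(f 1) ⋯
monomial : Poly → (ℕ → ℕ) → Ser
monomial p f α = if does (List.≡-dec ℕ._≟_ (applyUpTo f (length α)) α) then p else []

applyUpTo-cong : ∀ {A : Set} {f g : ℕ → A} → (∀ i → f i ≡ g i) → ∀ n → applyUpTo f n ≡ applyUpTo g n
applyUpTo-cong f≗g zero    = refl
applyUpTo-cong f≗g (suc n) = cong₂ _∷_ (f≗g 0) (applyUpTo-cong (f≗g ∘ suc) n)

monomial-cong : ∀ p {f g} → (∀ i → f i ≡ g i) → ∀ α → monomial p f α ≡ monomial p g α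
monomial-cong p f≗g α =
  cong (λ β → if does (List.≡-dec ℕ._≟_ β α) then p else []) (applyUpTo-cong f≗g (length α))

monomial-∷ : ∀ p f a α →
             monomial p f (a ∷ α) ≡ (if does (f 0 ℕ.≟ a) then monomial p (f ∘ suc) α else [])
monomial-∷ p f a α with does (f 0 ℕ.≟ a)
... | true  = refl
... | false = refl

-- `monomial` reads its exponents only up to the length of α, so the raised exponent has to lie in
-- this range to be seen.
monomial-mulX : ∀ p c α f g → c < length α → g c ≡ suc (f c) → (∀ i → i ≢ c → g i ≡ f i) →
                monomial p g α ≃ mulX c (monomial p f) α
monomial-mulX p zero    (a ∷ α) f g _ gc g≗f rewrite monomial-∷ p g a α | gc = go a
  where
  go : ∀ a → (if does (suc (f 0) ℕ.≟ a) then monomial p (g ∘ suc) α else []) ≃ mulX 0 (monomial p f) (a ∷ α)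
  go zero    = ≃-refl
  go (suc a) = ≃-reflexive (≡.trans
    (cong (if does (f 0 ℕ.≟ a) then_else []) (monomial-cong p (λ i → g≗f (suc i) λ ()) α))
    (≡.sym (monomial-∷ p f a α)))
monomial-mulX p (suc c) (a ∷ α) f g (s≤s c<l) gc g≗f = begin
  monomial p g (a ∷ α)
    ≡⟨ monomial-∷ p g a α ⟩
  (if does (g 0 ℕ.≟ a) then monomial p (g ∘ suc) α else [])
    ≡⟨ cong (λ b → if does (b ℕ.≟ a) then monomial p (g ∘ suc) α else []) (g≗f 0 λ ()) ⟩
  (if does (f 0 ℕ.≟ a) then monomial p (g ∘ suc) α else [])
    ≈⟨ choose (does (f 0 ℕ.≟ a)) ⟩
  mulX c (λ β → if does (f 0 ℕ.≟ a) then monomial p (f ∘ suc) β else []) α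
    ≈⟨ Φ-cong (mulX-linear c α) (λ β → ≃-reflexive (monomial-∷ p f a β)) ⟨
  mulX (suc c) (monomial p f) (a ∷ α) ∎
  where
  choose : ∀ b → (if b then monomial p (g ∘ suc) α else []) ≃
                 mulX c (λ β → if b then monomial p (f ∘ suc) β else []) α
  choose true  = monomial-mulX p c α (f ∘ suc) (g ∘ suc) c<l gc (λ i i≢c → g≗f (suc i) (i≢c ∘ ℕ.suc-injective))
  choose false = ≃-sym (mulX-𝟎 c α)

occurrences : ∀ {n} → Coloring n → ℕ → ℕ
occurrences κ i = count (ℕ._≟ suc i) κ

weight≡occurrences : ∀ {n} N (κ : Coloring n) → weight N κ ≡ applyUpTo (occurrences κ) N
weight≡occurrences N κ = ≡.trans
  (cong (map (λ i → count (ℕ._≟ i) κ)) (List.map-applyUpTo id suc N)) (List.map-applyUpTo suc _ N)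

monomial-∷-coloring : ∀ {n} p c (κ : Coloring n) α → c < length α →
  monomial p (occurrences (suc c ∷ κ)) α ≃ mulX c (monomial p (occurrences κ)) α
monomial-∷-coloring p c κ α c<l = monomial-mulX p c α (occurrences κ) (occurrences (suc c ∷ κ)) c<l
  (cong (λ b → (if b then suc else id) (occurrences κ c)) (dec-true (suc c ℕ.≟ suc c) refl))
  (λ i i≢c → cong (λ b → (if b then suc else id) (occurrences κ i))
    (dec-false (suc c ℕ.≟ suc i) (i≢c ∘ ≡.sym ∘ ℕ.suc-injective)))

[1⋯]-sum : ∀ N f → ∑ [1⋯ N ] f ≃ ∑ (upTo N) (f ∘ suc)
[1⋯]-sum N f = ∑-map suc (upTo N)

monomial-additive : ∀ f α → Additive (λ p → monomial p f α)
monomial-additive f α with does (List.≡-dec ℕ._≟_ (applyUpTo f (length α)) α)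
... | true  = id-additive
... | false = 𝟎-additive

wordSum≃word : ∀ n c α → c < length α →
  ∑ (vectors [1⋯ length α ] n) (λ κ → monomial (colorTerm (suc c ∷ κ)) (occurrences (suc c ∷ κ)) α) ≃
  word n c α
wordSum≃word zero c α c<l = begin
  monomial (t^ 0) (occurrences (suc c ∷ [])) α ⊕ []
    ≈⟨ ⊕-identityʳ _ ⟩
  monomial (t^ 0) (occurrences (suc c ∷ [])) α
    ≈⟨ monomial-∷-coloring (t^ 0) c [] α c<l ⟩
  mulX c (monomial (t^ 0) (λ _ → 0)) α
    ≈⟨ Φ-cong (mulX-linear c α) (λ β → ≃-reflexive (constant β)) ⟩
  mulX c (const (t^ 0)) α ∎
  where
  constant : ∀ β → monomial (t^ 0) (λ _ → 0) β ≡ const (t^ 0) β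
  constant []          = refl
  constant (zero ∷ β)  = constant β
  constant (suc b ∷ β) = refl
wordSum≃word (suc n) c α c<l = begin
  ∑ (vectors [1⋯ l ] (suc n)) (λ κ → monomial (colorTerm (suc c ∷ κ)) (occurrences (suc c ∷ κ)) α)
    ≈⟨ ∑-cartesianProductWith _∷_ [1⋯ l ] (vectors [1⋯ l ] n) ⟩
  ∑ [1⋯ l ] (λ d → ∑ (vectors [1⋯ l ] n) (λ κ →
    monomial (colorTerm (suc c ∷ d ∷ κ)) (occurrences (suc c ∷ d ∷ κ)) α))
    ≈⟨ [1⋯]-sum l _ ⟩
  ∑ (upTo l) (λ d → ∑ (vectors [1⋯ l ] n) (λ κ →
    monomial (colorTerm (suc c ∷ suc d ∷ κ)) (occurrences (suc c ∷ suc d ∷ κ)) α))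
    ≈⟨ ∑-cong (upTo l) (λ d → ∑-cong (vectors [1⋯ l ] n) (λ κ → ≃-trans
         (f-cong (monomial-additive (occurrences (suc c ∷ suc d ∷ κ)) α) (colorTerm-∷ c d κ))
         (monomial-∷-coloring (step c d (colorTerm (suc d ∷ κ))) c (suc d ∷ κ) α c<l))) ⟩
  ∑ (upTo l) (λ d → ∑ (vectors [1⋯ l ] n) (λ κ →
    mulX c (monomial (step c d (colorTerm (suc d ∷ κ))) (occurrences (suc d ∷ κ))) α))
    ≈⟨ ∑-cong (upTo l) (λ d → ∑-linear (mulX-linear c α) (vectors [1⋯ l ] n) _) ⟨
  ∑ (upTo l) (λ d → mulX c (λ β → ∑ (vectors [1⋯ l ] n) (λ κ →
    monomial (step c d (colorTerm (suc d ∷ κ))) (occurrences (suc d ∷ κ)) β)) α)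
    ≈⟨ ∑-linear (mulX-linear c α) (upTo l) _ ⟨
  mulX c (λ β → ∑ (upTo l) (λ d → ∑ (vectors [1⋯ l ] n) (λ κ →
    monomial (step c d (colorTerm (suc d ∷ κ))) (occurrences (suc d ∷ κ)) β))) α
    -- Dividing by x_{c+1} keeps the number of variables, so the bound l on the letters is also the
    -- one used by `∑step`.
    ≈⟨ mulX-cong-deg c α (λ β _ eq _ → inner β eq) ⟩
  mulX c (∑step c (word n)) α ∎
  where
  l = length α

  monomial-step : ∀ d p f β → monomial (step c d p) f β ≃ step c d (monomial p f β)
  monomial-step d p f β with does (List.≡-dec ℕ._≟_ (applyUpTo f (length β)) β)
  ... | true  = ≃-refl
  ... | false = ≃-sym (f-𝟎 (step-additive c d))

  inner : ∀ β → length β ≡ l →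
    ∑ (upTo l) (λ d → ∑ (vectors [1⋯ l ] n) (λ κ →
      monomial (step c d (colorTerm (suc d ∷ κ))) (occurrences (suc d ∷ κ)) β)) ≃
    ∑step c (word n) β
  inner β eq rewrite ≡.sym eq = ∑-cong-∈ (upTo (length β)) λ d d∈ → begin
    ∑ (vectors [1⋯ length β ] n) (λ κ →
      monomial (step c d (colorTerm (suc d ∷ κ))) (occurrences (suc d ∷ κ)) β)
      ≈⟨ ∑-cong (vectors [1⋯ length β ] n) (λ κ →
           monomial-step d (colorTerm (suc d ∷ κ)) (occurrences (suc d ∷ κ)) β) ⟩
    ∑ (vectors [1⋯ length β ] n) (λ κ →
      step c d (monomial (colorTerm (suc d ∷ κ)) (occurrences (suc d ∷ κ)) β))
      ≈⟨ ∑-additive (vectors [1⋯ length β ] n) (step-additive c d) ⟨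
    step c d (∑ (vectors [1⋯ length β ] n) (λ κ →
      monomial (colorTerm (suc d ∷ κ)) (occurrences (suc d ∷ κ)) β))
      ≈⟨ f-cong (step-additive c d) (wordSum≃word n d β (∈-upTo⁻ d∈)) ⟩
    step c d (word n d β) ∎

X-path≃words : ∀ n α → X (path (suc n)) α ≃ words n α
X-path≃words n α = begin
  X (path (suc n)) α
    ≡⟨ sumₚ-map _ (filter colored? (vectors [1⋯ l ] (suc n))) ⟩
  ∑ (filter colored? (vectors [1⋯ l ] (suc n))) (λ κ → t^ asc (path (suc n)) κ)
    ≈⟨ ∑-filter colored? (vectors [1⋯ l ] (suc n)) ⟩
  ∑ (vectors [1⋯ l ] (suc n)) (λ κ → if does (colored? κ) then t^ asc (path (suc n)) κ else [])
    ≈⟨ ∑-cong (vectors [1⋯ l ] (suc n)) (≃-reflexive ∘ term) ⟩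
  ∑ (vectors [1⋯ l ] (suc n)) (λ κ → monomial (colorTerm κ) (occurrences κ) α)
    ≈⟨ ∑-cartesianProductWith _∷_ [1⋯ l ] (vectors [1⋯ l ] n) ⟩
  ∑ [1⋯ l ] (λ c → ∑ (vectors [1⋯ l ] n) (λ κ → monomial (colorTerm (c ∷ κ)) (occurrences (c ∷ κ)) α))
    ≈⟨ [1⋯]-sum l _ ⟩
  ∑ (upTo l) (λ c → ∑ (vectors [1⋯ l ] n) (λ κ →
    monomial (colorTerm (suc c ∷ κ)) (occurrences (suc c ∷ κ)) α))
    ≈⟨ ∑-cong-∈ (upTo l) (λ c c∈ → wordSum≃word n c α (∈-upTo⁻ c∈)) ⟩
  words n α ∎
  where
  l = length α

  colored? : ∀ κ → Dec (Proper (path (suc n)) κ × weight l κ ≡ α)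
  colored? κ = proper? (path (suc n)) κ ×-dec List.≡-dec ℕ._≟_ (weight l κ) α

  term : ∀ κ → (if does (colored? κ) then t^ asc (path (suc n)) κ else []) ≡
               monomial (colorTerm κ) (occurrences κ) α
  term κ rewrite weight≡occurrences l κ
    with does (proper? (path (suc n)) κ) | does (List.≡-dec ℕ._≟_ (applyUpTo (occurrences κ) l) α)
  ... | true  | true  = refl
  ... | true  | false = refl
  ... | false | true  = refl
  ... | false | false = refl

-- Partitions obtained from gaps

≥-decTotalOrder : DecTotalOrder 0ℓ 0ℓ 0ℓ
≥-decTotalOrder = Flip.decTotalOrder ℕ.≤-decTotalOrder

open Sort ≥-decTotalOrder using (sort; sort-↭; sort-↗)

partitionOf : List ℕ → List ℕ
partitionOf ks = sort (map suc ks)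

partitionOf-isPartition : ∀ ks → IsPartition (sum (map suc ks)) (partitionOf ks)
partitionOf-isPartition ks = sort-↗ (map suc ks) ,
  All-resp-↭ (↭-sym (sort-↭ (map suc ks))) (All.map⁺ (All.universal (λ _ → s≤s z≤n) ks)) ,
  sum-↭ (sort-↭ (map suc ks))

-- A multiset has only one weakly decreasing arrangement. Thus each orientation belongs to AO_λ for
-- exactly one λ.
↭-partition⇔ : ∀ {n μ} ks → IsPartition n μ → (ks ↭ map (_∸ 1) μ) ⇔ (μ ≡ partitionOf ks)
↭-partition⇔ {n} {μ} ks (μ↗ , μ>0 , _) = mk⇔
  (λ p → ≋⇒≡ (↗↭↗⇒≋ (DecTotalOrder.totalOrder ≥-decTotalOrder) μ↗ (sort-↗ (map suc ks))
    (↭⇒↭ₛ (↭-trans (↭-reflexive (≡.sym (suc-∸1 μ>0)))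
      (↭-trans (map⁺ suc (↭-sym p)) (↭-sym (sort-↭ (map suc ks))))))))
  (λ { refl → ↭-trans (↭-reflexive (≡.trans (≡.sym (List.map-id ks)) (List.map-∘ ks)))
      (map⁺ (_∸ 1) (↭-sym (sort-↭ (map suc ks)))) })
  where
  suc-∸1 : ∀ {μ} → All (1 ≤_) μ → map suc (map (_∸ 1) μ) ≡ μ
  suc-∸1 []            = refl
  suc-∸1 (s≤s _ ∷ μ>0) = cong₂ _∷_ refl (suc-∸1 μ>0)

-- The list of partitions

module _ {A : Set} where

  ∈-vectors : ∀ {xs : List A} ys → All (_∈ xs) ys → fromList ys ∈ vectors xs (length ys)
  ∈-vectors []       []         = here refl
  ∈-vectors (y ∷ ys) (y∈ ∷ ys∈) = ∈-cartesianProductWith⁺ _∷_ y∈ (∈-vectors ys ys∈)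

  vectors-unique : ∀ {xs : List A} → Unique xs → ∀ n → Unique (vectors xs n)
  vectors-unique xs! zero    = [] ∷ []
  vectors-unique xs! (suc n) = Unique.cartesianProductWith⁺ _∷_ Vec.∷-injective xs! (vectors-unique xs! n)

  toList-injective : ∀ {n} {xs ys : Vec A n} → toList xs ≡ toList ys → xs ≡ ys
  toList-injective {xs = xs} {ys} eq =
    ≡.trans (≡.sym (Vec.cast-is-id refl xs)) (Vec.toList-injective refl xs ys eq)

partitions-isPartition : ∀ n → All (IsPartition n) (partitions n)
partitions-isPartition n = All.all-filter (isPartition? n)
  (concatMap (λ k → map toList (vectors [1⋯ n ] k)) (upTo (suc n)))

partitions-complete : ∀ {n μ} → IsPartition n μ → μ ∈ partitions n
partitions-complete {n} {μ} p@(_ , μ>0 , sum≡n) = ∈-filter⁺ (isPartition? n)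
  (∈-concatMap⁺ (λ k → map toList (vectors [1⋯ n ] k)) (lose (∈-upTo⁺ length<) μ∈)) p
  where
  length≤sum : ∀ {μ} → All (1 ≤_) μ → length μ ≤ sum μ
  length≤sum []            = z≤n
  length≤sum (μ≥1 ∷ μ>0) = ℕ.+-mono-≤ μ≥1 (length≤sum μ>0)

  length< : length μ < suc n
  length< = s≤s (≡.subst (length μ ≤_) sum≡n (length≤sum μ>0))

  part∈ : ∀ {k} → 1 ≤ k × k ≤ n → k ∈ [1⋯ n ]
  part∈ (s≤s {n = k} _ , k<n) = ∈-map⁺ suc (∈-upTo⁺ k<n)

  μ∈ : μ ∈ map toList (vectors [1⋯ n ] (length μ))
  μ∈ = ≡.subst (_∈ map toList (vectors [1⋯ n ] (length μ))) (Vec.toList∘fromList μ)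
    (∈-map⁺ toList (∈-vectors μ (All.map part∈ (All.zip (μ>0 , partition-parts≤ p)))))

partitions-unique : ∀ n → Unique (partitions n)
partitions-unique n = Unique.filter⁺ (isPartition? n) (Unique.concat⁺
  (All.map⁺ (All.universal (λ k → Unique.map⁺ toList-injective (vectors-unique [1⋯n]-unique k)) (upTo (suc n))))
  (AllPairs.map⁺ (AllPairs.map (λ i≢j {_} (∈i , ∈j) → i≢j (≡.trans (≡.sym (length-∈ ∈i)) (length-∈ ∈j)))
    (Unique.upTo⁺ (suc n)))))
  where
  [1⋯n]-unique : Unique [1⋯ n ]
  [1⋯n]-unique = Unique.map⁺ ℕ.suc-injective (Unique.upTo⁺ n)

  length-∈ : ∀ {k μ} → μ ∈ map toList (vectors [1⋯ n ] k) → length μ ≡ k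
  length-∈ μ∈ with ∈-map⁻ toList μ∈
  ... | v , _ , refl = Vec.length-toList v

-- The expansion of the orientation series and the conclusion

open OrientationSeries +ₚ-0-commutativeMonoid t·_ t·-additive (t^ 0)
open LinearIndependence +ₚ-0-commutativeMonoid +ₚ-cancelˡ

AOSum : ℕ → List ℕ → Poly
AOSum n μ = sumₚ (map (λ a → t^ (ascₒ (path n) a)) (AO (path n) μ))

AOSum≃∑bits : ∀ n μ → AOSum (suc n) μ ≃
  ∑ (bits n) (λ b → if does (initial 0 b ↭? map (_∸ 1) μ) then pow (trues b) (t^ 0) else [])
AOSum≃∑bits n μ = begin
  AOSum (suc n) μ
    ≡⟨ sumₚ-map _ (AO (path (suc n)) μ) ⟩
  ∑ (AO (path (suc n)) μ) (λ a → t^ (ascₒ (path (suc n)) a))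
    ≈⟨ ∑-filter (inAO? μ) (orientations (arcs (path (suc n)))) ⟩
  ∑ (orientations (arcs (path (suc n)))) term
    ≡⟨ cong (λ as → ∑ as term) (orientations-path n) ⟩
  ∑ (map orient (bits n)) term
    ≈⟨ ∑-map orient (bits n) {term} ⟩
  ∑ (bits n) (term ∘ orient)
    ≈⟨ ∑-cong (bits n) (λ b → ≃-reflexive (cong₂ (λ c p → if c then p else [])
         (does-⇔ (inAO⇔ b) (inAO? μ (orient b)) (initial 0 b ↭? map (_∸ 1) μ))
         (≡.trans (cong t^_ (ascₒ-orient b)) (≡.sym (pow-one (trues b)))))) ⟩
  ∑ (bits n) (λ b → if does (initial 0 b ↭? map (_∸ 1) μ) then pow (trues b) (t^ 0) else []) ∎
  where
  term : List (Arc (suc n)) → Poly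
  term a = if does (inAO? μ a) then t^ (ascₒ (path (suc n)) a) else []

  inAO⇔ : ∀ b → InAO μ (orient b) ⇔ (initial 0 b ↭ map (_∸ 1) μ)
  inAO⇔ b = mk⇔ (λ (_ , p) → ↭-trans (↭-sym (gaps-orient b)) p)
                (λ p → orient-acyclic b , ↭-trans (gaps-orient b) p)

-- After the sums are exchanged, a fixed orientation contributes only at the partition formed by its
-- gaps, where e_λ is the product of its e_{k+1} in another order.
AO-expansion : ∀ n α →
  ∑ (partitions (suc n)) (λ μ → mulEs μ (const (AOSum (suc n) μ)) α) ≃ orientationSeries n α
AO-expansion n α = begin
  ∑ (partitions (suc n)) (λ μ → mulEs μ (const (AOSum (suc n) μ)) α)
    ≈⟨ ∑-cong (partitions (suc n)) (λ μ → ≃-trans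
         (f-cong (mulEs-const-additive μ α) (AOSum≃∑bits n μ))
         (∑-additive (bits n) (mulEs-const-additive μ α))) ⟩
  ∑ (partitions (suc n)) (λ μ → ∑ (bits n) (summand μ))
    ≈⟨ ∑-comm (partitions (suc n)) (bits n) summand ⟩
  ∑ (bits n) (λ b → ∑ (partitions (suc n)) (λ μ → summand μ b))
    ≈⟨ ∑-cong (bits n) single ⟩
  orientationSeries n α ∎
  where
  summand : List ℕ → Vec Bool n → Poly
  summand μ b =
    mulEs μ (const (if does (initial 0 b ↭? map (_∸ 1) μ) then pow (trues b) (t^ 0) else [])) α

  single : ∀ b → ∑ (partitions (suc n)) (λ μ → summand μ b) ≃
                 mulEs (map suc (initial 0 b)) (const (pow (trues b) (t^ 0))) α
  single b = begin
    ∑ (partitions (suc n)) (λ μ → summand μ b)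
      ≈⟨ ∑-single {f = λ μ → summand μ b} (partitions-unique (suc n)) (partitions-complete ν-isPartition) others ⟩
    summand ν b
      ≡⟨ cong (λ c → mulEs ν (const (if c then pow (trues b) (t^ 0) else [])) α)
           (dec-true (initial 0 b ↭? map (_∸ 1) ν)
             (Equivalence.from (↭-partition⇔ (initial 0 b) ν-isPartition) refl)) ⟩
    mulEs ν (const (pow (trues b) (t^ 0))) α
      ≈⟨ mulEs-↭ (sort-↭ (map suc (initial 0 b))) α ⟩
    mulEs (map suc (initial 0 b)) (const (pow (trues b) (t^ 0))) α ∎
    where
    ν : List ℕ
    ν = partitionOf (initial 0 b)

    ν-isPartition : IsPartition (suc n) ν
    ν-isPartition = ≡.subst (λ m → IsPartition m ν) (sum-initial 0 b) (partitionOf-isPartition (initial 0 b))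

    others : ∀ μ → μ ∈ partitions (suc n) → μ ≢ ν → summand μ b ≃ []
    others μ μ∈ μ≢ν = ≃-trans
      (≃-reflexive (cong (λ c → mulEs μ (const (if c then pow (trues b) (t^ 0) else [])) α)
        (dec-false (initial 0 b ↭? map (_∸ 1) μ) (μ≢ν ∘ Equivalence.to
          (↭-partition⇔ (initial 0 b) (All.lookup (partitions-isPartition (suc n)) μ∈))))))
      (f-𝟎 (mulEs-const-additive μ α))

proposition15 : (n : ℕ) → 1 ≤ n →
    (c : List ℕ → Poly) →
    X (path n) ≈ₛ sumₛ (map (λ parts → c parts · e[ parts ]) (partitions n)) →
    ∀ parts → IsPartition n parts →
    c parts ≈ sumₚ (map (λ a → t^ (ascₒ (path n) a)) (AO (path n) parts))
-- The family c is arbitrary among those expanding X, so it is compared with the family of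
-- orientation sums, which yields the same series in degree n + 1.
proposition15 (suc n) _ c X≈ parts isPartition = _≋_.coeffs
  (independent n c (AOSum (suc n)) (partitions (suc n)) (partitions-unique (suc n))
    (partitions-isPartition (suc n)) expansions-agree parts (partitions-complete isPartition))
  where
  expansions-agree : ∀ α → sum α ≡ suc n →
    ∑ (partitions (suc n)) (λ μ → mulEs μ (const (c μ)) α) ≃
    ∑ (partitions (suc n)) (λ μ → mulEs μ (const (AOSum (suc n) μ)) α)
  expansions-agree α degree = begin
    ∑ (partitions (suc n)) (λ μ → mulEs μ (const (c μ)) α)
      ≈⟨ ∑-cong (partitions (suc n)) (λ μ → ·-e[]≃mulEs (c μ) μ α) ⟨
    ∑ (partitions (suc n)) (λ μ → (c μ · e[ μ ]) α)
      ≈⟨ ∑-map (λ μ → c μ · e[ μ ]) (partitions (suc n)) {λ F → F α} ⟨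
    ∑ (map (λ μ → c μ · e[ μ ]) (partitions (suc n))) (λ F → F α)
      ≡⟨ sumₚ-map (λ F → F α) (map (λ μ → c μ · e[ μ ]) (partitions (suc n))) ⟨
    sumₛ (map (λ μ → c μ · e[ μ ]) (partitions (suc n))) α
      ≈⟨ mk≋ (X≈ α) ⟨
    X (path (suc n)) α
      ≈⟨ X-path≃words n α ⟩
    words n α
      ≈⟨ words≃orientationSeries n α degree ⟩
    orientationSeries n α
      ≈⟨ AO-expansion n α ⟨
    ∑ (partitions (suc n)) (λ μ → mulEs μ (const (AOSum (suc n) μ)) α) ∎
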